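{- As $n\to\infty$, $R(n) = O(n^{1/3})$, $R_{\text{no3l}}(n) = O(n^{1/3})$, $R_{\text{no4c}}(n) = O(n^{\log_2(7)/3})$, and $R_{\text{gen}}(n) = O(n^{\log_2(7)/3})$.
   Context: An angle determined by a finite set $\mathcal Q\subset\mathbb{R}^2$ is given by a center $q\in\mathcal Q$ and an unordered pair $\{p,r\}$ of distinct endpoints in $\mathcal Q\setminus\{q\}$, with measure $\angle pqr$; angles of measure $0$ or $\pi$ are ignored. $\mathcal Q$ determines no repeated angle if no two different such angles have equal measure in $(0,\pi)$. For a finite set $\mathcal{P}\subset\mathbb{R}^2$, $R(\mathcal P)$ is the maximum size of a subset $\mathcal Q\subseteq\mathcal P$ that determines no repeated angle. $R(n)$ is the minimum of $R(\mathcal P)$ over all sets $\mathcal P\subset\mathbb{R}^2$ of $n$ points, not all collinear. $R_{\text{no3l}}(n)$, $R_{\text{no4c}}(n)$, $R_{\text{gen}}(n)$ are the same minimum restricted further to, respectively, sets with no three collinear points; sets with no four points on a common circle; sets in general position (no three points collinear and no four points on a common circle). $f = O(g)$ means there is a constant $C$ with $f(n) \le C g(n)$ for all sufficiently large $n$. -}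

module Defs where

open import Data.Fin.Base as Fin using (Fin)
open import Data.Fin.Subset using (Subset; _∈_; ∣_∣)
open import Data.Integer.Base as ℤ using (ℤ)
open import Data.Nat.Base as ℕ using (ℕ; zero; suc; _!)
open import Data.Nat.Properties as ℕₚ using (_!≢0)
open import Data.Product using (Σ; ∃; ∃-syntax; _×_; _,_)
open import Data.Rational.Base as ℚ using (ℚ; 0ℚ; 1ℚ; ½)
open import Data.Rational.Properties as ℚₚ using ()
open import Data.Rational.Solver using (module +-*-Solver)
open import Data.Sum.Base using (_⊎_)
open import Data.Unit.Base using (⊤)
open import Function.Base using (_∘_)
open import Function.Bundles using (_⇔_)
open import Function.Definitions using (Injective)
open import Relation.Binary.PropositionalEquality
  using (_≡_; _≢_; refl; sym; trans; cong; cong₂; subst; module ≡-Reasoning)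
open import Relation.Nullary using (¬_)

Eventually : (ℕ → Set) → Set
Eventually P = ∃[ N ] (∀ n → N ℕ.≤ n → P n)

IsCauchy : (ℕ → ℚ) → Set
IsCauchy x = ∀ ε → 0ℚ ℚ.< ε →
  ∃[ N ] (∀ m n → N ℕ.≤ m → N ℕ.≤ n → ℚ.∣ x m ℚ.- x n ∣ ℚ.< ε)

-- Equality of reals is _≈_, not _≡_.
record ℝ : Set where
  constructor real
  field
    seq    : ℕ → ℚ
    cauchy : IsCauchy seq

open ℝ public

infix 4 _≈_ _≤_ _<_

_≈_ : ℝ → ℝ → Set
x ≈ y = ∀ ε → 0ℚ ℚ.< ε → Eventually λ n → ℚ.∣ seq x n ℚ.- seq y n ∣ ℚ.< ε

_≤_ : ℝ → ℝ → Set
x ≤ y = ∀ ε → 0ℚ ℚ.< ε → Eventually λ n → seq x n ℚ.≤ seq y n ℚ.+ ε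

_<_ : ℝ → ℝ → Set
x < y = ∃[ ε ] (0ℚ ℚ.< ε × Eventually λ n → seq x n ℚ.+ ε ℚ.≤ seq y n)

private abstract
  half-pos : ∀ {ε} → 0ℚ ℚ.< ε → 0ℚ ℚ.< ½ ℚ.* ε
  half-pos {ε} ε>0 =
    subst (ℚ._< ½ ℚ.* ε) (ℚₚ.*-zeroʳ ½) (ℚₚ.*-monoʳ-<-pos ½ ε>0)

  halves : ∀ ε → ½ ℚ.* ε ℚ.+ ½ ℚ.* ε ≡ ε
  halves ε = trans (sym (ℚₚ.*-distribʳ-+ ε ½ ½)) (ℚₚ.*-identityˡ ε)

  ∣∣-split : ∀ {p} q r {α β} → p ≡ q ℚ.+ r →
             ℚ.∣ q ∣ ℚ.< α → ℚ.∣ r ∣ ℚ.< β → ℚ.∣ p ∣ ℚ.< α ℚ.+ β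
  ∣∣-split q r refl q<α r<β =
    ℚₚ.≤-<-trans (ℚₚ.∣p+q∣≤∣p∣+∣q∣ q r) (ℚₚ.+-mono-< q<α r<β)

  bounded : ∀ x → IsCauchy x →
            ∃[ B ] (0ℚ ℚ.< B × Eventually λ n → ℚ.∣ x n ∣ ℚ.< B)
  bounded x cx with cx 1ℚ (ℚₚ.positive⁻¹ 1ℚ)
  ... | N , close = 1ℚ ℚ.+ (1ℚ ℚ.+ ℚ.∣ x N ∣) , B>0 , N , below
    where
    abs< : ℚ.∣ x N ∣ ℚ.< 1ℚ ℚ.+ ℚ.∣ x N ∣
    abs< = subst (ℚ._< 1ℚ ℚ.+ ℚ.∣ x N ∣) (ℚₚ.+-identityˡ _)
                 (ℚₚ.+-monoˡ-< ℚ.∣ x N ∣ (ℚₚ.positive⁻¹ 1ℚ))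
    B>0 : 0ℚ ℚ.< 1ℚ ℚ.+ (1ℚ ℚ.+ ℚ.∣ x N ∣)
    B>0 = subst (ℚ._< 1ℚ ℚ.+ (1ℚ ℚ.+ ℚ.∣ x N ∣)) (ℚₚ.+-identityˡ 0ℚ)
      (ℚₚ.+-mono-< (ℚₚ.positive⁻¹ 1ℚ) (ℚₚ.≤-<-trans (ℚₚ.0≤∣p∣ (x N)) abs<))
    below : ∀ n → N ℕ.≤ n → ℚ.∣ x n ∣ ℚ.< 1ℚ ℚ.+ (1ℚ ℚ.+ ℚ.∣ x N ∣)
    below n N≤n = ∣∣-split (x n ℚ.- x N) (x N)
      (solve 2 (λ a b → a := (a :- b) :+ b) refl (x n) (x N))
      (close n N N≤n ℕₚ.≤-refl) abs<
      where open +-*-Solver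

  ∣*∣-< : ∀ p q {B δ} (B>0 : 0ℚ ℚ.< B) →
          ℚ.∣ p ∣ ℚ.< B → ℚ.∣ q ∣ ℚ.< δ → ℚ.∣ p ℚ.* q ∣ ℚ.< B ℚ.* δ
  ∣*∣-< p q {B} {δ} B>0 p<B q<δ = subst (ℚ._< B ℚ.* δ) (sym (ℚₚ.∣p*q∣≡∣p∣*∣q∣ p q))
    (ℚₚ.≤-<-trans
      (ℚₚ.*-monoʳ-≤-nonNeg ℚ.∣ q ∣ {{ℚ.nonNegative (ℚₚ.0≤∣p∣ q)}} (ℚₚ.<⇒≤ p<B))
      (ℚₚ.*-monoʳ-<-pos B {{ℚ.positive B>0}} q<δ))

  divide : ∀ {B ε} → 0ℚ ℚ.< B → 0ℚ ℚ.< ε → ∃[ δ ] (0ℚ ℚ.< δ × B ℚ.* δ ≡ ε)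
  divide {B} {ε} B>0 ε>0 =
    (ℚ.1/ B) ℚ.* ε ,
    subst (ℚ._< (ℚ.1/ B) ℚ.* ε) (ℚₚ.*-zeroʳ (ℚ.1/ B))
          (ℚₚ.*-monoʳ-<-pos (ℚ.1/ B) {{ℚₚ.1/pos⇒pos B}} ε>0) ,
    trans (sym (ℚₚ.*-assoc B (ℚ.1/ B) ε))
          (trans (cong (ℚ._* ε) (ℚₚ.*-inverseʳ B)) (ℚₚ.*-identityˡ ε))
    where
    instance
      B-pos : ℚ.Positive B
      B-pos = ℚ.positive B>0
      B-nz : ℚ.NonZero B
      B-nz = ℚₚ.pos⇒nonZero B

  ⊔ˡ : ∀ {M N k} → M ℕ.⊔ N ℕ.≤ k → M ℕ.≤ k
  ⊔ˡ {M} {N} = ℕₚ.≤-trans (ℕₚ.m≤m⊔n M N)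

  ⊔ʳ : ∀ {M N k} → M ℕ.⊔ N ℕ.≤ k → N ℕ.≤ k
  ⊔ʳ {M} {N} = ℕₚ.≤-trans (ℕₚ.m≤n⊔m M N)

  +-cauchy : ∀ x y → IsCauchy x → IsCauchy y → IsCauchy (λ n → x n ℚ.+ y n)
  +-cauchy x y cx cy ε ε>0
    with cx (½ ℚ.* ε) (half-pos ε>0) | cy (½ ℚ.* ε) (half-pos ε>0)
  ... | M , px | N , py = M ℕ.⊔ N , λ m n m≥ n≥ →
    subst (ℚ.∣ (x m ℚ.+ y m) ℚ.- (x n ℚ.+ y n) ∣ ℚ.<_) (halves ε)
      (∣∣-split (x m ℚ.- x n) (y m ℚ.- y n)
        (solve 4 (λ a b c d → (a :+ b) :- (c :+ d) := (a :- c) :+ (b :- d))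
          refl
          (x m) (y m) (x n) (y n))
        (px m n (⊔ˡ {M} {N} m≥) (⊔ˡ {M} {N} n≥))
        (py m n (⊔ʳ {M} {N} m≥) (⊔ʳ {M} {N} n≥)))
    where open +-*-Solver

  neg-cauchy : ∀ x → IsCauchy x → IsCauchy (λ n → ℚ.- x n)
  neg-cauchy x cx ε ε>0 with cx ε ε>0
  ... | N , px = N , λ m n m≥ n≥ →
    subst (λ z → ℚ.∣ z ∣ ℚ.< ε)
      (solve 2 (λ a b → b :- a := (:- a) :- (:- b)) refl (x m) (x n))
      (px n m n≥ m≥)
    where open +-*-Solver

  product-split : ∀ a b c d →
    a ℚ.* b ℚ.- c ℚ.* d ≡ a ℚ.* (b ℚ.- d) ℚ.+ d ℚ.* (a ℚ.- c)
  product-split a b c d = sym (begin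
    a ℚ.* (b ℚ.- d) ℚ.+ d ℚ.* (a ℚ.- c)
      ≡⟨ cong₂ ℚ._+_ (expand a b d) (expand d a c) ⟩
    (a ℚ.* b ℚ.- a ℚ.* d) ℚ.+ (d ℚ.* a ℚ.- d ℚ.* c)
      ≡⟨ cong₂ (λ u v → (a ℚ.* b ℚ.- a ℚ.* d) ℚ.+ (u ℚ.- v))
               (ℚₚ.*-comm d a) (ℚₚ.*-comm d c) ⟩
    (a ℚ.* b ℚ.- a ℚ.* d) ℚ.+ (a ℚ.* d ℚ.- c ℚ.* d)
      ≡⟨ solve 3 (λ u v w → (u :- v) :+ (v :- w) := u :- w) refl
               (a ℚ.* b) (a ℚ.* d) (c ℚ.* d) ⟩
    a ℚ.* b ℚ.- c ℚ.* d ∎)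
    where
    open ≡-Reasoning
    open +-*-Solver
    expand : ∀ u v w → u ℚ.* (v ℚ.- w) ≡ u ℚ.* v ℚ.- u ℚ.* w
    expand u v w = trans (ℚₚ.*-distribˡ-+ u v (ℚ.- w))
      (cong (u ℚ.* v ℚ.+_) (sym (ℚₚ.neg-distribʳ-* u w)))

  *-close : ∀ {A α B β ε} x y x′ y′ → 0ℚ ℚ.< A → 0ℚ ℚ.< B →
            A ℚ.* α ≡ ½ ℚ.* ε → B ℚ.* β ≡ ½ ℚ.* ε →
            ℚ.∣ x ∣ ℚ.< A → ℚ.∣ y ℚ.- y′ ∣ ℚ.< α →
            ℚ.∣ y′ ∣ ℚ.< B → ℚ.∣ x ℚ.- x′ ∣ ℚ.< β →
            ℚ.∣ x ℚ.* y ℚ.- x′ ℚ.* y′ ∣ ℚ.< ε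
  *-close {A} {α} {B} {β} {ε} x y x′ y′ A>0 B>0 Aα Bβ x<A y-close y<B x-close =
    subst (ℚ.∣ x ℚ.* y ℚ.- x′ ℚ.* y′ ∣ ℚ.<_)
      (trans (cong₂ ℚ._+_ Aα Bβ) (halves ε))
      (∣∣-split (x ℚ.* (y ℚ.- y′)) (y′ ℚ.* (x ℚ.- x′))
        (product-split x y x′ y′)
        (∣*∣-< x (y ℚ.- y′) A>0 x<A y-close)
        (∣*∣-< y′ (x ℚ.- x′) B>0 y<B x-close))

  *-cauchy : ∀ x y → IsCauchy x → IsCauchy y → IsCauchy (λ n → x n ℚ.* y n)
  *-cauchy x y cx cy ε ε>0 =
    let A , A>0 , K , x<A = bounded x cx
        B , B>0 , L , y<B = bounded y cy
        α , α>0 , Aα      = divide A>0 (half-pos ε>0)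
        β , β>0 , Bβ      = divide B>0 (half-pos ε>0)
        M , y-close       = cy α α>0
        N , x-close       = cx β β>0
    in (K ℕ.⊔ L) ℕ.⊔ (M ℕ.⊔ N) , λ m n m≥ n≥ →
      let m≥M⊔N = ⊔ʳ {K ℕ.⊔ L} m≥
          n≥M⊔N = ⊔ʳ {K ℕ.⊔ L} n≥
      in *-close (x m) (y m) (x n) (y n) A>0 B>0 Aα Bβ
           (x<A m (⊔ˡ {K} (⊔ˡ {K ℕ.⊔ L} m≥)))
           (y-close m n (⊔ˡ {M} m≥M⊔N) (⊔ˡ {M} n≥M⊔N))
           (y<B n (⊔ʳ {K} (⊔ˡ {K ℕ.⊔ L} n≥)))
           (x-close m n (⊔ʳ {M} m≥M⊔N) (⊔ʳ {M} n≥M⊔N))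

infixl 6 _+_ _-_
infixl 7 _*_
infix  8 -_
infixr 8 _^_

fromℚ : ℚ → ℝ
fromℚ q = real (λ _ → q)
  λ ε ε>0 → 0 , λ _ _ _ _ → subst (λ z → ℚ.∣ z ∣ ℚ.< ε) (sym (ℚₚ.+-inverseʳ q)) ε>0

_+_ : ℝ → ℝ → ℝ
x + y = real (λ n → seq x n ℚ.+ seq y n)
             (+-cauchy (seq x) (seq y) (cauchy x) (cauchy y))

-_ : ℝ → ℝ
- x = real (λ n → ℚ.- seq x n) (neg-cauchy (seq x) (cauchy x))

_-_ : ℝ → ℝ → ℝ
x - y = x + (- y)

_*_ : ℝ → ℝ → ℝ
x * y = real (λ n → seq x n ℚ.* seq y n)
             (*-cauchy (seq x) (seq y) (cauchy x) (cauchy y))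

0ℝ 1ℝ : ℝ
0ℝ = fromℚ 0ℚ
1ℝ = fromℚ 1ℚ

_^_ : ℝ → ℕ → ℝ
x ^ zero  = 1ℝ
x ^ suc n = x * (x ^ n)

_⟶_ : (ℕ → ℝ) → ℝ → Set
s ⟶ y = ∀ ε → 0ℚ ℚ.< ε →
  Eventually λ n → s n ≤ y + fromℚ ε × y ≤ s n + fromℚ ε

cosTerm : ℝ → ℕ → ℝ
cosTerm x k =
  fromℚ (((ℤ.-1ℤ ℤ.^ k) ℚ./ ((2 ℕ.* k) !)) {{(2 ℕ.* k) !≢0}}) * x ^ (2 ℕ.* k)

partialSum : (ℕ → ℝ) → ℕ → ℝ
partialSum t zero    = 0ℝ
partialSum t (suc n) = partialSum t n + t n

-- Cos, Sqrt, Norm and ∠ are functions given by their graphs.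
Cos_is_ : ℝ → ℝ → Set
Cos x is y = partialSum (cosTerm x) ⟶ y

Sqrt_is_ : ℝ → ℝ → Set
Sqrt x is y = 0ℝ ≤ y × y * y ≈ x

-- π is the least positive real whose cosine is -1.
IsPi : ℝ → Set
IsPi π = 0ℝ < π × Cos π is (- 1ℝ) ×
         (∀ t → 0ℝ < t → Cos t is (- 1ℝ) → π ≤ t)

record Point : Set where
  constructor pt
  field
    xc yc : ℝ

open Point public

_≈ₚ_ : Point → Point → Set
p ≈ₚ q = xc p ≈ xc q × yc p ≈ yc q

_−ₚ_ : Point → Point → Point
p −ₚ q = pt (xc p - xc q) (yc p - yc q)

_·_ : Point → Point → ℝ
u · v = xc u * xc v + yc u * yc v

Norm_is_ : Point → ℝ → Set
Norm u is ℓ = Sqrt (u · u) is ℓ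

-- The measure of ∠pqr (meant for p ≠ q ≠ r) is the θ ∈ [0,π] with
-- |p-q| |r-q| cos θ = (p-q) · (r-q).
∠_,_,_is_ : Point → Point → Point → ℝ → Set
∠ p , q , r is θ =
  0ℝ ≤ θ × (∃[ π ] (IsPi π × θ ≤ π)) ×
  (∃[ c ] ∃[ ℓ₁ ] ∃[ ℓ₂ ]
     (Cos θ is c × Norm (p −ₚ q) is ℓ₁ × Norm (r −ₚ q) is ℓ₂ ×
      ℓ₁ * ℓ₂ * c ≈ (p −ₚ q) · (r −ₚ q)))

record Line : Set where
  field
    a b c      : ℝ
    nontrivial : ¬ (a ≈ 0ℝ × b ≈ 0ℝ)

record Circle : Set where
  field
    centre : Point
    radius : ℝ
    pos    : 0ℝ < radius

_onLine_ : Point → Line → Set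
p onLine l = a * xc p + b * yc p ≈ c
  where open Line l

_onCircle_ : Point → Circle → Set
p onCircle o = (p −ₚ centre) · (p −ₚ centre) ≈ radius * radius
  where open Circle o

Points : ℕ → Set
Points n = Fin n → Point

Distinct : ∀ {n} → Points n → Set
Distinct = Injective _≡_ _≈ₚ_

Collinear : ∀ {n} → Points n → Set
Collinear P = ∃[ l ] (∀ i → P i onLine l)

Concyclic : ∀ {n} → Points n → Set
Concyclic P = ∃[ o ] (∀ i → P i onCircle o)

-- A set of n points is a Distinct family indexed by Fin n, and its subsets are
-- given by the subsets of Fin n.  The endpoints of an angle are listed in
-- increasing order of index (see _∈∠_), so that each unordered pair occurs
-- exactly once.
record AngleIndex (n : ℕ) : Set where
  constructor angle
  field
    end₁ centre end₂ : Fin n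

record _∈∠_ {n : ℕ} (α : AngleIndex n) (Q : Subset n) : Set where
  open AngleIndex α
  field
    end₁∈   : end₁ ∈ Q
    centre∈ : centre ∈ Q
    end₂∈   : end₂ ∈ Q
    end₁<   : end₁ Fin.< end₂
    end₁≢   : end₁ ≢ centre
    end₂≢   : end₂ ≢ centre

module _ {n : ℕ} (P : Points n) where

  Measure_is_ : AngleIndex n → ℝ → Set
  Measure (angle i j k) is θ = ∠ P i , P j , P k is θ

  Ignored : AngleIndex n → Set
  Ignored α = (Measure α is 0ℝ) ⊎ (∃[ π ] (IsPi π × Measure α is π))

  -- The measure exists and is unique for distinct points, so having the same
  -- θ as measure is equality of measures.
  EqualMeasure : AngleIndex n → AngleIndex n → Set
  EqualMeasure α β = ∀ θ → (Measure α is θ) ⇔ (Measure β is θ)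

  NoRepeatedAngle : Subset n → Set
  NoRepeatedAngle Q = ∀ α β → α ∈∠ Q → β ∈∠ Q → ¬ Ignored α → ¬ Ignored β →
                      EqualMeasure α β → α ≡ β

-- R[ P ]≡ k : the largest subset of P without repeated angles has size k.
R[_]≡_ : ∀ {n} → Points n → ℕ → Set
R[_]≡_ {n} P k = (∃[ Q ] (NoRepeatedAngle P Q × ∣ Q ∣ ≡ k)) ×
                 (∀ Q → NoRepeatedAngle P Q → ∣ Q ∣ ℕ.≤ k)

PointClass : Set₁
PointClass = ∀ {n} → Points n → Set

record Admissible (𝒞 : PointClass) {n : ℕ} (P : Points n) : Set where
  field
    distinct     : Distinct P
    notCollinear : ¬ Collinear P
    inClass      : 𝒞 P

-- MinR 𝒞 n m : the minimum of R(P) over the n-point sets P of class 𝒞, not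
-- all collinear, is m.
MinR : PointClass → ℕ → ℕ → Set
MinR 𝒞 n m =
  (Σ (Points n) λ P → Admissible 𝒞 P × R[ P ]≡ m) ×
  (∀ (P : Points n) k → Admissible 𝒞 P → R[ P ]≡ k → m ℕ.≤ k)

NoThreeCollinear : PointClass
NoThreeCollinear {n} P =
  ∀ (f : Fin 3 → Fin n) → Injective _≡_ _≡_ f → ¬ Collinear (P ∘ f)

NoFourConcyclic : PointClass
NoFourConcyclic {n} P =
  ∀ (f : Fin 4 → Fin n) → Injective _≡_ _≡_ f → ¬ Concyclic (P ∘ f)

Unrestricted : PointClass
Unrestricted P = ⊤

GeneralPosition : PointClass
GeneralPosition P = NoThreeCollinear P × NoFourConcyclic P

R R-no3l R-no4c R-gen : ℕ → ℕ → Set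
R      = MinR Unrestricted
R-no3l = MinR NoThreeCollinear
R-no4c = MinR NoFourConcyclic
R-gen  = MinR GeneralPosition

-- A real exponent e > 0 is given by its upper cut: e p q means e < p / q,
-- for q > 0.
Exponent : Set₁
Exponent = ℕ → ℕ → Set

one-third : Exponent
one-third p q = q ℕ.< 3 ℕ.* p

-- log₂ 7 / 3 < p / q iff log₂ (7 ^ q) < 3 p.
log₂7/3 : Exponent
log₂7/3 p q = 7 ℕ.^ q ℕ.< 2 ℕ.^ (3 ℕ.* p)

-- m ≤ C · n ^ e.  For n ≥ 1, n ^ e is the infimum of n ^ (p / q) over the
-- rationals p / q > e, and m ≤ C · n ^ (p / q) is compared after taking
-- q-th powers.
_≤_·_^ₑ_ : ℕ → ℕ → ℕ → Exponent → Set
m ≤ C · n ^ₑ e = ∀ p q → 0 ℕ.< q → e p q → m ℕ.^ q ℕ.≤ C ℕ.^ q ℕ.* n ℕ.^ p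

-- f(n) = O(n ^ e), for a function f known by its graph F.  That f(n) is
-- defined is asserted up to double negation, since choosing a minimum over
-- all real configurations is not effective.
_isO[n^_] : (ℕ → ℕ → Set) → Exponent → Set
F isO[n^ e ] = ∃[ C ] ∃[ N ] (∀ n → N ℕ.≤ n →
  ¬ ¬ (∃[ m ] F n m) × (∀ m → F n m → m ≤ C · n ^ₑ e))

{-# OPTIONS --safe #-}

-- A set Q of k points without repeated angles determines of the order of k³
-- angles of distinct measures, so R(P)³ = O(M) if P determines only M angles.
--
-- For no-three-collinear sets take the powers of (3 + 4i)² / 25 on the unit
-- circle: by the inscribed angle theorem n of them determine at most 4n angles.
-- In general position take a generic projection of the cube {0,1}ᵈ: an angle pqr
-- depends only on p - q and r - q, which gives 7ᵈ angles for 2ᵈ points.  Generic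
-- vectors are found one at a time as v = t (1 , m), with first m and then t so
-- large that finitely many nonzero polynomials of degree at most 2 do not vanish.
--
-- Both configurations are rational, and equality of angles is only ever derived
-- from proportional scalar products.  Thus of the cosine series only its value
-- at 0 and the uniqueness of limits are needed, to exclude the angles 0 and π.

module Submission where

open import Data.Bool.Base using (Bool; true; false)
open import Data.Bool.Properties as Boolₚ using ()
open import Data.Empty using (⊥-elim)
open import Data.Fin.Base as Fin
  using (Fin; zero; suc; combine; remQuot; toℕ; fromℕ<; inject≤; _↑ʳ_)
open import Data.Fin.Patterns using (0F; 1F; 2F; 3F; 4F; 5F; 6F)
open import Data.Fin.Properties as Finₚ
  using (injective⇒≤; combine-injective; combine-remQuot; toℕ-inject≤; toℕ-↑ʳ; toℕ<n)
open import Data.Fin.Subset as Subset using (Subset; inside; outside; _∈_; ∣_∣)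
open import Data.Fin.Subset.Properties using (∣p∣≤n; ∉⊥)
open import Data.Integer.Base as ℤ using (ℤ; +_; -[1+_])
open import Data.Integer.Properties as ℤₚ using ()
open import Data.Integer.Tactic.RingSolver as ℤ-Solver using ()
open import Data.Nat.Base as ℕ using (ℕ; zero; suc; z≤n; s≤s)
open import Data.Nat.Coprimality as Coprime using (1-coprimeTo)
open import Data.Nat.DivMod using (m≡m%n+[m/n]*n; m%n<n; m/n*n≤m)
open import Data.Nat.Induction using (<-rec)
open import Data.Nat.Properties as ℕₚ using ()
open import Data.Nat.Solver using (module +-*-Solver)
open import Data.Product using (Σ; ∃-syntax; _×_; _,_; proj₁; proj₂)
open import Data.Rational.Base as ℚ using (ℚ; 0ℚ; 1ℚ; ½)
open import Data.Rational.Properties as ℚₚ using ()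
open import Data.Rational.Unnormalised.Base using (*≡*)
open import Data.Rational.Unnormalised.Properties as ℚᵘₚ using ()
open import Data.Sum.Base using (_⊎_; inj₁; inj₂)
open import Data.Unit.Base using (tt)
open import Data.Vec.Base using (Vec; []; _∷_; here; there)
open import Data.Vec.Properties as Vecₚ using ()
open import Function.Base using (_∘_; _$_; case_of_)
open import Function.Bundles using (mk⇔)
open import Function.Definitions using (Injective)
open import Relation.Binary.Definitions using (Tri; tri<; tri≈; tri>)
open import Relation.Binary.PropositionalEquality
open import Relation.Nullary using (¬_; Dec; yes; no; contradiction; ¬?)
open import Relation.Nullary.Decidable using (decidable-stable; dec⇒maybe)
open import Tactic.RingSolver using (solve-∀)
open import Tactic.RingSolver.Core.AlmostCommutativeRing
  using (AlmostCommutativeRing; fromCommutativeRing)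
open import Algebra.Properties.Group ℚₚ.+-0-group using (x∙y⁻¹≈ε⇒x≈y)
open import Defs

-- Null sequences and Cauchy reals

-- No measure is ever computed. `EqualMeasure` asks for an equivalence at each θ, so a witness for
-- one angle is turned into a witness for another: the cosine value is kept and the two norms are
-- multiplied by nonnegative rationals. A negative factor would lead to the supplementary angle;
-- this is why the circle count carries two sign bits, hence 4n instead of n.
--
-- In the cube, a new vector v adds the translate by v to the points built so far. Along a fixed
-- direction the determinants that must not vanish are polynomials in the length t. If two points
-- lie in each copy, the leading coefficient depends on the direction and may vanish for a bad one;
-- it is itself a nonzero polynomial in the slope m, which forces the order in which m and t are
-- chosen.
--
-- Three blocks of h = ⌊k/3⌋ points give h³ ≤ M, hence k³ ≤ 125 M. With M = 4n, or M = 7 · 7ᵈ where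
-- 2ᵈ < n, the factor stays below 1000 = 10³, so the constant is 10 in both cases.

ℚ-ring : AlmostCommutativeRing _ _
ℚ-ring = fromCommutativeRing ℚₚ.+-*-commutativeRing (λ x → dec⇒maybe (0ℚ ℚₚ.≟ x))

0<½* : ∀ {ε} → 0ℚ ℚ.< ε → 0ℚ ℚ.< ½ ℚ.* ε
0<½* {ε} ε>0 = subst (ℚ._< ½ ℚ.* ε) (ℚₚ.*-zeroʳ ½) (ℚₚ.*-monoʳ-<-pos ½ ε>0)

½*+½* : ∀ ε → ½ ℚ.* ε ℚ.+ ½ ℚ.* ε ≡ ε
½*+½* ε = trans (sym (ℚₚ.*-distribʳ-+ ε ½ ½)) (ℚₚ.*-identityˡ ε)

½*< : ∀ {ε} → 0ℚ ℚ.< ε → ½ ℚ.* ε ℚ.< ε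
½*< {ε} ε>0 = subst₂ ℚ._<_ (ℚₚ.+-identityʳ _) (½*+½* ε)
  (ℚₚ.+-monoʳ-< (½ ℚ.* ε) (0<½* ε>0))

quotient : ∀ {B ε} → 0ℚ ℚ.< B → 0ℚ ℚ.< ε → ∃[ δ ] (0ℚ ℚ.< δ × B ℚ.* δ ≡ ε)
quotient {B} {ε} B>0 ε>0 =
  ℚ.1/ B ℚ.* ε ,
  subst (ℚ._< ℚ.1/ B ℚ.* ε) (ℚₚ.*-zeroʳ (ℚ.1/ B))
        (ℚₚ.*-monoʳ-<-pos (ℚ.1/ B) {{ℚₚ.1/pos⇒pos B}} ε>0) ,
  trans (sym (ℚₚ.*-assoc B (ℚ.1/ B) ε))
        (trans (cong (ℚ._* ε) (ℚₚ.*-inverseʳ B)) (ℚₚ.*-identityˡ ε))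
  where
  instance
    B-pos : ℚ.Positive B
    B-pos = ℚ.positive B>0
    B-nz : ℚ.NonZero B
    B-nz = ℚₚ.pos⇒nonZero B

eventually-map : ∀ {P Q : ℕ → Set} → (∀ n → P n → Q n) → Eventually P → Eventually Q
eventually-map f (N , p) = N , λ n n≥N → f n (p n n≥N)

eventually-map₂ : ∀ {P Q S : ℕ → Set} → (∀ n → P n → Q n → S n) →
                  Eventually P → Eventually Q → Eventually S
eventually-map₂ f (M , p) (N , q) = M ℕ.⊔ N , λ n n≥ →
  f n (p n (ℕₚ.≤-trans (ℕₚ.m≤m⊔n M N) n≥)) (q n (ℕₚ.≤-trans (ℕₚ.m≤n⊔m M N) n≥))

-- x ≈ y unfolds to Null of the pointwise difference, and null sequences form
-- an ideal among the Cauchy sequences.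
Null : (ℕ → ℚ) → Set
Null u = ∀ ε → 0ℚ ℚ.< ε → Eventually λ n → ℚ.∣ u n ∣ ℚ.< ε

null-resp : ∀ {u v} → (∀ n → u n ≡ v n) → Null u → Null v
null-resp u≗v nu ε ε>0 =
  eventually-map (λ n → subst (λ z → ℚ.∣ z ∣ ℚ.< ε) (u≗v n)) (nu ε ε>0)

null-+ : ∀ {u v} → Null u → Null v → Null (λ n → u n ℚ.+ v n)
null-+ {u} {v} nu nv ε ε>0 =
  eventually-map₂
    (λ n p q → subst (ℚ.∣ u n ℚ.+ v n ∣ ℚ.<_) (½*+½* ε)
      (ℚₚ.≤-<-trans (ℚₚ.∣p+q∣≤∣p∣+∣q∣ (u n) (v n)) (ℚₚ.+-mono-< p q)))
    (nu _ (0<½* ε>0)) (nv _ (0<½* ε>0))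

null-neg : ∀ {u} → Null u → Null (λ n → ℚ.- u n)
null-neg {u} nu ε ε>0 =
  eventually-map (λ n → subst (ℚ._< ε) (sym (ℚₚ.∣-p∣≡∣p∣ (u n)))) (nu ε ε>0)

bounded : ∀ x → ∃[ B ] (0ℚ ℚ.< B × Eventually λ n → ℚ.∣ seq x n ∣ ℚ.< B)
bounded x with cauchy x 1ℚ (ℚₚ.positive⁻¹ 1ℚ)
... | N , close = 1ℚ ℚ.+ ℚ.∣ seq x N ∣ , B>0 , N , below
  where
  B>0 : 0ℚ ℚ.< 1ℚ ℚ.+ ℚ.∣ seq x N ∣
  B>0 = ℚₚ.+-mono-<-≤ (ℚₚ.positive⁻¹ 1ℚ) (ℚₚ.0≤∣p∣ (seq x N))
  below : ∀ n → N ℕ.≤ n → ℚ.∣ seq x n ∣ ℚ.< 1ℚ ℚ.+ ℚ.∣ seq x N ∣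
  below n N≤n = ℚₚ.≤-<-trans
    (subst (λ z → ℚ.∣ z ∣ ℚ.≤ ℚ.∣ seq x n ℚ.- seq x N ∣ ℚ.+ ℚ.∣ seq x N ∣)
      (cancel (seq x n) (seq x N)) (ℚₚ.∣p+q∣≤∣p∣+∣q∣ (seq x n ℚ.- seq x N) (seq x N)))
    (ℚₚ.+-monoˡ-< ℚ.∣ seq x N ∣ (close n N N≤n ℕₚ.≤-refl))
    where
    cancel : ∀ a b → (a ℚ.- b) ℚ.+ b ≡ a
    cancel = solve-∀ ℚ-ring

null-* : ∀ x {u} → Null u → Null (λ n → seq x n ℚ.* u n)
null-* x {u} nu ε ε>0 =
  let B , B>0 , x<B = bounded x
      δ , δ>0 , Bδ≡ε = quotient B>0 ε>0
  in eventually-map₂ (λ n xn<B un<δ → subst₂ ℚ._<_ (sym (ℚₚ.∣p*q∣≡∣p∣*∣q∣ (seq x n) (u n))) Bδ≡ε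
       (ℚₚ.≤-<-trans
         (ℚₚ.*-monoʳ-≤-nonNeg ℚ.∣ u n ∣ {{ℚ.nonNegative (ℚₚ.0≤∣p∣ (u n))}} (ℚₚ.<⇒≤ xn<B))
         (ℚₚ.*-monoʳ-<-pos B {{ℚ.positive B>0}} un<δ)))
     x<B (nu δ δ>0)

0<∣∣ : ∀ {q} → q ≢ 0ℚ → 0ℚ ℚ.< ℚ.∣ q ∣
0<∣∣ {q} q≢0 = ℚₚ.≰⇒> λ ∣q∣≤0 →
  q≢0 (ℚₚ.∣p∣≡0⇒p≡0 q (ℚₚ.≤-antisym ∣q∣≤0 (ℚₚ.0≤∣p∣ q)))

-- The way back from reals to rationals: an identity known up to null sequences becomes an equation
-- in ℚ once both sides are constant. The tolerance |q| itself yields the contradiction.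
null-const : ∀ {q} → Null (λ _ → q) → q ≡ 0ℚ
null-const {q} nq with q ℚₚ.≟ 0ℚ
... | yes q≡0 = q≡0
... | no  q≢0 with nq ℚ.∣ q ∣ (0<∣∣ q≢0)
...   | N , small = contradiction (small N ℕₚ.≤-refl) (ℚₚ.<-irrefl refl)

≗⇒≈ : ∀ {x y} → (∀ n → seq x n ≡ seq y n) → x ≈ y
≗⇒≈ {x} {y} x≗y ε ε>0 = 0 , λ n _ →
  subst (λ z → ℚ.∣ z ∣ ℚ.< ε)
    (trans (sym (ℚₚ.+-inverseʳ (seq x n))) (cong (λ z → seq x n ℚ.- z) (x≗y n))) ε>0

≈-sym : ∀ {x y} → x ≈ y → y ≈ x
≈-sym {x} {y} x≈y = null-resp (λ n → flip (seq x n) (seq y n)) (null-neg x≈y)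
  where
  flip : ∀ a b → ℚ.- (a ℚ.- b) ≡ b ℚ.- a
  flip = solve-∀ ℚ-ring

≈-trans : ∀ {x y z} → x ≈ y → y ≈ z → x ≈ z
≈-trans {x} {y} {z} x≈y y≈z =
  null-resp (λ n → telescope (seq x n) (seq y n) (seq z n)) (null-+ x≈y y≈z)
  where
  telescope : ∀ a b c → (a ℚ.- b) ℚ.+ (b ℚ.- c) ≡ a ℚ.- c
  telescope = solve-∀ ℚ-ring

*-cong : ∀ {x x′ y y′} → x ≈ x′ → y ≈ y′ → x * y ≈ x′ * y′
*-cong {x} {x′} {y} {y′} x≈x′ y≈y′ =
  null-resp (λ n → split (seq x n) (seq x′ n) (seq y n) (seq y′ n))
    (null-+ (null-* x y≈y′) (null-* y′ x≈x′))
  where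
  split : ∀ a a′ b b′ → a ℚ.* (b ℚ.- b′) ℚ.+ b′ ℚ.* (a ℚ.- a′) ≡ a ℚ.* b ℚ.- a′ ℚ.* b′
  split = solve-∀ ℚ-ring

fromℚ-injective : ∀ {p q} → fromℚ p ≈ fromℚ q → p ≡ q
fromℚ-injective {p} {q} p≈q = x∙y⁻¹≈ε⇒x≈y p q (null-const p≈q)

≤-antisym : ∀ {x y} → x ≤ y → y ≤ x → x ≈ y
≤-antisym {x} {y} x≤y y≤x ε ε>0 =
  eventually-map₂ (λ n p q → ℚₚ.≤-<-trans (within p q) (½*< ε>0))
    (x≤y _ (0<½* ε>0)) (y≤x _ (0<½* ε>0))
  where
  within : ∀ {a b δ} → a ℚ.≤ b ℚ.+ δ → b ℚ.≤ a ℚ.+ δ → ℚ.∣ a ℚ.- b ∣ ℚ.≤ δ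
  within {a} {b} {δ} p q with ℚₚ.∣p∣≡p∨∣p∣≡-p (a ℚ.- b)
  ... | inj₁ eq = subst₂ ℚ._≤_ (sym eq) (cancel b δ) (ℚₚ.+-monoˡ-≤ (ℚ.- b) p)
    where
    cancel : ∀ b δ → (b ℚ.+ δ) ℚ.- b ≡ δ
    cancel = solve-∀ ℚ-ring
  ... | inj₂ eq = subst₂ ℚ._≤_ (trans (flip a b) (sym eq)) (cancel a δ) (ℚₚ.+-monoˡ-≤ (ℚ.- a) q)
    where
    flip : ∀ a b → b ℚ.- a ≡ ℚ.- (a ℚ.- b)
    flip = solve-∀ ℚ-ring
    cancel : ∀ b δ → (b ℚ.+ δ) ℚ.- b ≡ δ
    cancel = solve-∀ ℚ-ring

⟶-≤ : ∀ {s y z} → s ⟶ y → s ⟶ z → y ≤ z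
⟶-≤ {s} {y} {z} s⟶y s⟶z ε ε>0 =
  let M , p = s⟶y δ δ>0
      N , q = s⟶z δ δ>0
      k     = M ℕ.⊔ N
  in eventually-map₂ (λ m p q → subst (seq y m ℚ.≤_) (quarters (seq z m) ε)
       (ℚₚ.≤-trans p (ℚₚ.+-monoˡ-≤ δ (ℚₚ.+-monoˡ-≤ δ q))))
     (proj₂ (p k (ℕₚ.m≤m⊔n M N)) δ δ>0) (proj₁ (q k (ℕₚ.m≤n⊔m M N)) δ δ>0)
  where
  -- Two tolerances come from the limits and two from the definition of `_≤_`, so each gets a
  -- quarter of ε.
  δ   = ½ ℚ.* (½ ℚ.* ε)
  δ>0 = 0<½* (0<½* ε>0)
  quarters : ∀ a ε → (((a ℚ.+ ½ ℚ.* (½ ℚ.* ε)) ℚ.+ ½ ℚ.* (½ ℚ.* ε)) ℚ.+ ½ ℚ.* (½ ℚ.* ε))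
                       ℚ.+ ½ ℚ.* (½ ℚ.* ε) ≡ a ℚ.+ ε
  quarters a ε = trans (regroup a (½ ℚ.* (½ ℚ.* ε)))
    (cong (a ℚ.+_) (trans (cong₂ ℚ._+_ (½*+½* (½ ℚ.* ε)) (½*+½* (½ ℚ.* ε))) (½*+½* ε)))
    where
    regroup : ∀ a δ → (((a ℚ.+ δ) ℚ.+ δ) ℚ.+ δ) ℚ.+ δ ≡ a ℚ.+ ((δ ℚ.+ δ) ℚ.+ (δ ℚ.+ δ))
    regroup = solve-∀ ℚ-ring

⟶-unique : ∀ {s y z} → s ⟶ y → s ⟶ z → y ≈ z
⟶-unique {s} {y} {z} s⟶y s⟶z =
  ≤-antisym {y} {z} (⟶-≤ {s} {y} {z} s⟶y s⟶z) (⟶-≤ {s} {z} {y} s⟶z s⟶y)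

cos0 : Cos 0ℝ is 1ℝ
-- Every nonempty partial sum equals 1 exactly, since all later terms contain a factor 0. The empty
-- sum is 0, hence the threshold 1.
cos0 ε ε>0 = 1 , λ { (suc n) _ → bound n }
  where
  term : ∀ k m → seq (cosTerm 0ℝ (suc k)) m ≡ 0ℚ
  term k m = trans (cong (c ℚ.*_) (ℚₚ.*-zeroˡ p)) (ℚₚ.*-zeroʳ c)
    where
    c = seq (fromℚ (((ℤ.-1ℤ ℤ.^ suc k) ℚ./ ((2 ℕ.* suc k) ℕ.!)) {{(2 ℕ.* suc k) ℕₚ.!≢0}})) m
    p = seq (0ℝ ^ (k ℕ.+ suc (k ℕ.+ 0))) m
  sum≡1 : ∀ n m → seq (partialSum (cosTerm 0ℝ) (suc n)) m ≡ 1ℚ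
  sum≡1 zero    m = refl
  sum≡1 (suc n) m = trans (cong₂ ℚ._+_ (sum≡1 n m) (term n m)) (ℚₚ.+-identityʳ 1ℚ)
  ≤+ : ∀ {x y δ} → x ≡ y → 0ℚ ℚ.< δ → x ℚ.≤ (y ℚ.+ ε) ℚ.+ δ
  ≤+ {x} {δ = δ} refl δ>0 = begin
    x                     ≡⟨ pad x ⟩
    (x ℚ.+ 0ℚ) ℚ.+ 0ℚ     ≤⟨ ℚₚ.+-mono-≤ (ℚₚ.+-monoʳ-≤ x (ℚₚ.<⇒≤ ε>0)) (ℚₚ.<⇒≤ δ>0) ⟩
    (x ℚ.+ ε) ℚ.+ δ       ∎
    where
    open ℚₚ.≤-Reasoning
    pad : ∀ x → x ≡ (x ℚ.+ 0ℚ) ℚ.+ 0ℚ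
    pad = solve-∀ ℚ-ring
  bound : ∀ n → partialSum (cosTerm 0ℝ) (suc n) ≤ 1ℝ + fromℚ ε ×
                1ℝ ≤ partialSum (cosTerm 0ℝ) (suc n) + fromℚ ε
  bound n = (λ δ δ>0 → 0 , λ m _ → ≤+ (sum≡1 n m) δ>0) ,
            (λ δ δ>0 → 0 , λ m _ → ≤+ (sym (sum≡1 n m)) δ>0)

0≤-scale : ∀ {s x} → 0ℚ ℚ.≤ s → 0ℝ ≤ x → 0ℝ ≤ fromℚ s * x
0≤-scale {s} {x} s≥0 x≥0 ε ε>0 =
  -- Dividing by s + 1 instead of s keeps the divisor positive when s = 0.
  let δ , δ>0 , eq = quotient {s ℚ.+ 1ℚ} (ℚₚ.+-mono-≤-< s≥0 (ℚₚ.positive⁻¹ 1ℚ)) ε>0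
  in eventually-map (λ n h → begin
       0ℚ                          ≡⟨ sym (ℚₚ.*-zeroʳ s) ⟩
       s ℚ.* 0ℚ                    ≤⟨ ℚₚ.*-monoˡ-≤-nonNeg s {{ℚ.nonNegative s≥0}} h ⟩
       s ℚ.* (seq x n ℚ.+ δ)       ≡⟨ ℚₚ.*-distribˡ-+ s (seq x n) δ ⟩
       s ℚ.* seq x n ℚ.+ s ℚ.* δ   ≤⟨ ℚₚ.+-monoʳ-≤ (s ℚ.* seq x n) (sδ≤ δ δ>0) ⟩
       s ℚ.* seq x n ℚ.+ (s ℚ.+ 1ℚ) ℚ.* δ ≡⟨ cong (s ℚ.* seq x n ℚ.+_) eq ⟩
       s ℚ.* seq x n ℚ.+ ε         ∎)
     (x≥0 δ δ>0)
  where
  open ℚₚ.≤-Reasoning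
  sδ≤ : ∀ δ → 0ℚ ℚ.< δ → s ℚ.* δ ℚ.≤ (s ℚ.+ 1ℚ) ℚ.* δ
  sδ≤ δ δ>0 = ℚₚ.*-monoʳ-≤-nonNeg δ {{ℚ.nonNegative (ℚₚ.<⇒≤ δ>0)}}
    (subst (ℚ._≤ s ℚ.+ 1ℚ) (ℚₚ.+-identityʳ s) (ℚₚ.+-monoʳ-≤ s (ℚₚ.<⇒≤ (ℚₚ.positive⁻¹ 1ℚ))))

-- Points with rational coordinates

ℚ² : Set
ℚ² = ℚ × ℚ

infixl 6 _⊖_ _⊕_
_⊖_ _⊕_ : ℚ² → ℚ² → ℚ²
(a , b) ⊖ (c , d) = a ℚ.- c , b ℚ.- d
(a , b) ⊕ (c , d) = a ℚ.+ c , b ℚ.+ d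

dot cross : ℚ² → ℚ² → ℚ
dot   (a , b) (c , d) = a ℚ.* c ℚ.+ b ℚ.* d
cross (a , b) (c , d) = a ℚ.* d ℚ.- b ℚ.* c

orient : ℚ² → ℚ² → ℚ² → ℚ
orient p q r = cross (q ⊖ p) (r ⊖ p)

-- The determinant of the rows (v , |v|²) for v = a, b, c, which vanishes if the
-- origin, a, b and c are concyclic.
det₃ : ℚ² → ℚ² → ℚ² → ℚ
det₃ a b c = (dot a a ℚ.* cross b c ℚ.+ dot b b ℚ.* cross c a) ℚ.+ dot c c ℚ.* cross a b

incircle : ℚ² → ℚ² → ℚ² → ℚ² → ℚ
incircle p q r s = det₃ (q ⊖ p) (r ⊖ p) (s ⊖ p)

⟦_⟧ : ℚ² → Point
⟦ x , y ⟧ = pt (fromℚ x) (fromℚ y)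

*-cancelˡ-≢0 : ∀ {d x} → d ≢ 0ℚ → d ℚ.* x ≡ 0ℚ → x ≡ 0ℚ
*-cancelˡ-≢0 {d} {x} d≢0 dx≡0 = begin
  x                        ≡⟨ sym (ℚₚ.*-identityˡ x) ⟩
  1ℚ ℚ.* x                 ≡⟨ cong (ℚ._* x) (sym (ℚₚ.*-inverseˡ d)) ⟩
  (ℚ.1/ d ℚ.* d) ℚ.* x     ≡⟨ ℚₚ.*-assoc (ℚ.1/ d) d x ⟩
  ℚ.1/ d ℚ.* (d ℚ.* x)     ≡⟨ cong (ℚ.1/ d ℚ.*_) dx≡0 ⟩
  ℚ.1/ d ℚ.* 0ℚ            ≡⟨ ℚₚ.*-zeroʳ (ℚ.1/ d) ⟩
  0ℚ                       ∎
  where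
  open ≡-Reasoning
  instance
    d-nz : ℚ.NonZero d
    d-nz = ℚ.≢-nonZero d≢0

square≡0 : ∀ {x} → x ℚ.* x ≡ 0ℚ → x ≡ 0ℚ
square≡0 {x} xx≡0 with x ℚₚ.≟ 0ℚ
... | yes x≡0 = x≡0
... | no  x≢0 = *-cancelˡ-≢0 x≢0 xx≡0

null-scale : ∀ q {u} → Null u → Null (λ n → q ℚ.* u n)
null-scale q = null-* (fromℚ q)

null-sub : ∀ {u v} → Null u → Null v → Null (λ n → u n ℚ.- v n)
null-sub nu nv = null-+ nu (null-neg nv)

null-cancel : ∀ {d u} → d ≢ 0ℚ → Null (λ n → u n ℚ.* d) → Null u
null-cancel {d} {u} d≢0 nud =
  null-resp (λ n → begin
    ℚ.1/ d ℚ.* (u n ℚ.* d)   ≡⟨ ℚₚ.*-comm (ℚ.1/ d) (u n ℚ.* d) ⟩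
    (u n ℚ.* d) ℚ.* ℚ.1/ d   ≡⟨ ℚₚ.*-assoc (u n) d (ℚ.1/ d) ⟩
    u n ℚ.* (d ℚ.* ℚ.1/ d)   ≡⟨ cong (u n ℚ.*_) (ℚₚ.*-inverseʳ d) ⟩
    u n ℚ.* 1ℚ               ≡⟨ ℚₚ.*-identityʳ (u n) ⟩
    u n                      ∎)
  (null-scale (ℚ.1/ d) nud)
  where
  open ≡-Reasoning
  instance
    d-nz : ℚ.NonZero d
    d-nz = ℚ.≢-nonZero d≢0

-- Real lines, circles and measures at rational points

⟦⟧-injective : ∀ {p q} → ⟦ p ⟧ ≈ₚ ⟦ q ⟧ → p ≡ q
⟦⟧-injective (x≈ , y≈) = cong₂ _,_ (fromℚ-injective x≈) (fromℚ-injective y≈)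

-- Subtracting the equation at `i` removes c, and Cramer's rule then makes a · d and b · d null,
-- with d the orientation. The coefficients of the line are real, so the elimination runs termwise
-- on their sequences and only the rational d is cancelled.
¬collinear : ∀ {n} (p : Fin n → ℚ²) i j k → orient (p i) (p j) (p k) ≢ 0ℚ →
             ¬ Collinear (⟦_⟧ ∘ p)
¬collinear p i j k d≢0 (l , on) = nontrivial
  (null-resp (λ n → sym (x-0 (seq a n))) (null-cancel d≢0
    (null-resp (λ n → eliminate-b (seq a n) (seq b n) (seq c n) xi yi xj yj xk yk)
      (null-sub (null-scale (yk ℚ.- yi) (null-sub (on j) (on i)))
                (null-scale (yj ℚ.- yi) (null-sub (on k) (on i)))))) ,
   null-resp (λ n → sym (x-0 (seq b n))) (null-cancel d≢0
    (null-resp (λ n → eliminate-a (seq a n) (seq b n) (seq c n) xi yi xj yj xk yk)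
      (null-sub (null-scale (xj ℚ.- xi) (null-sub (on k) (on i)))
                (null-scale (xk ℚ.- xi) (null-sub (on j) (on i)))))))
  where
  open Line l
  xi = proj₁ (p i)
  yi = proj₂ (p i)
  xj = proj₁ (p j)
  yj = proj₂ (p j)
  xk = proj₁ (p k)
  yk = proj₂ (p k)
  x-0 : ∀ x → x ℚ.- 0ℚ ≡ x
  x-0 = ℚₚ.+-identityʳ
  eliminate-b : ∀ a b c xi yi xj yj xk yk →
    (yk ℚ.- yi) ℚ.* (((a ℚ.* xj ℚ.+ b ℚ.* yj) ℚ.- c) ℚ.- ((a ℚ.* xi ℚ.+ b ℚ.* yi) ℚ.- c)) ℚ.-
    (yj ℚ.- yi) ℚ.* (((a ℚ.* xk ℚ.+ b ℚ.* yk) ℚ.- c) ℚ.- ((a ℚ.* xi ℚ.+ b ℚ.* yi) ℚ.- c)) ≡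
    a ℚ.* ((xj ℚ.- xi) ℚ.* (yk ℚ.- yi) ℚ.- (yj ℚ.- yi) ℚ.* (xk ℚ.- xi))
  eliminate-b = solve-∀ ℚ-ring
  eliminate-a : ∀ a b c xi yi xj yj xk yk →
    (xj ℚ.- xi) ℚ.* (((a ℚ.* xk ℚ.+ b ℚ.* yk) ℚ.- c) ℚ.- ((a ℚ.* xi ℚ.+ b ℚ.* yi) ℚ.- c)) ℚ.-
    (xk ℚ.- xi) ℚ.* (((a ℚ.* xj ℚ.+ b ℚ.* yj) ℚ.- c) ℚ.- ((a ℚ.* xi ℚ.+ b ℚ.* yi) ℚ.- c)) ≡
    b ℚ.* ((xj ℚ.- xi) ℚ.* (yk ℚ.- yi) ℚ.- (yj ℚ.- yi) ℚ.* (xk ℚ.- xi))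
  eliminate-a = solve-∀ ℚ-ring

-- Subtracting the circle equation at `p i` leaves equations |A|² = 2 A · (centre - p i) and
-- likewise for B and C. Weighted with the cofactors, the centre drops out, because A (B × C) + B (C
-- × A) + C (A × B) = 0 in the plane, and `det₃ A B C` remains.
¬concyclic : ∀ {n} (p : Fin n → ℚ²) i j k l → incircle (p i) (p j) (p k) (p l) ≢ 0ℚ →
             ¬ Concyclic (⟦_⟧ ∘ p)
¬concyclic p i j k l d≢0 (o , on) = d≢0 $ null-const
  (null-resp (λ n → eliminate-centre (proj₁ A) (proj₂ A) (proj₁ B) (proj₂ B) (proj₁ C) (proj₂ C)
                            (u n) (v n))
    (null-+ (null-+ (null-scale (cross B C) (chord j))
                    (null-scale (cross C A) (chord k)))
            (null-scale (cross A B) (chord l))))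
  where
  open Circle o
  A = p j ⊖ p i
  B = p k ⊖ p i
  C = p l ⊖ p i
  u v : ℕ → ℚ
  u n = seq (xc centre) n ℚ.- proj₁ (p i)
  v n = seq (yc centre) n ℚ.- proj₂ (p i)
  subtract : ∀ x y x′ y′ a b r →
    (((x′ ℚ.- a) ℚ.* (x′ ℚ.- a) ℚ.+ (y′ ℚ.- b) ℚ.* (y′ ℚ.- b)) ℚ.- r) ℚ.-
    (((x ℚ.- a) ℚ.* (x ℚ.- a) ℚ.+ (y ℚ.- b) ℚ.* (y ℚ.- b)) ℚ.- r) ≡
    ((x′ ℚ.- x) ℚ.* (x′ ℚ.- x) ℚ.+ (y′ ℚ.- y) ℚ.* (y′ ℚ.- y)) ℚ.-
    ((x′ ℚ.- x) ℚ.* ((a ℚ.- x) ℚ.+ (a ℚ.- x)) ℚ.+ (y′ ℚ.- y) ℚ.* ((b ℚ.- y) ℚ.+ (b ℚ.- y)))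
  subtract = solve-∀ ℚ-ring
  chord : ∀ m → Null (λ n → dot (p m ⊖ p i) (p m ⊖ p i) ℚ.-
                            dot (p m ⊖ p i) (u n ℚ.+ u n , v n ℚ.+ v n))
  chord m = null-resp (λ n → subtract (proj₁ (p i)) (proj₂ (p i)) (proj₁ (p m)) (proj₂ (p m))
                                      (seq (xc centre) n) (seq (yc centre) n)
                                      (seq radius n ℚ.* seq radius n))
                      (null-sub (on m) (on i))
  eliminate-centre : ∀ a₁ a₂ b₁ b₂ c₁ c₂ u v →
    ((b₁ ℚ.* c₂ ℚ.- b₂ ℚ.* c₁) ℚ.* ((a₁ ℚ.* a₁ ℚ.+ a₂ ℚ.* a₂) ℚ.- (a₁ ℚ.* (u ℚ.+ u) ℚ.+ a₂ ℚ.* (v ℚ.+ v))) ℚ.+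
     (c₁ ℚ.* a₂ ℚ.- c₂ ℚ.* a₁) ℚ.* ((b₁ ℚ.* b₁ ℚ.+ b₂ ℚ.* b₂) ℚ.- (b₁ ℚ.* (u ℚ.+ u) ℚ.+ b₂ ℚ.* (v ℚ.+ v)))) ℚ.+
     (a₁ ℚ.* b₂ ℚ.- a₂ ℚ.* b₁) ℚ.* ((c₁ ℚ.* c₁ ℚ.+ c₂ ℚ.* c₂) ℚ.- (c₁ ℚ.* (u ℚ.+ u) ℚ.+ c₂ ℚ.* (v ℚ.+ v))) ≡
    ((a₁ ℚ.* a₁ ℚ.+ a₂ ℚ.* a₂) ℚ.* (b₁ ℚ.* c₂ ℚ.- b₂ ℚ.* c₁) ℚ.+
     (b₁ ℚ.* b₁ ℚ.+ b₂ ℚ.* b₂) ℚ.* (c₁ ℚ.* a₂ ℚ.- c₂ ℚ.* a₁)) ℚ.+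
     (c₁ ℚ.* c₁ ℚ.+ c₂ ℚ.* c₂) ℚ.* (a₁ ℚ.* b₂ ℚ.- a₂ ℚ.* b₁)
  eliminate-centre = solve-∀ ℚ-ring

-- Cosine ±1 is the equality case of Cauchy-Schwarz, and by Lagrange's identity the defect |A|²|B|²
-- - (A · B)² is the square of the cross product. The form κ² = 1 treats the measures 0 and π at
-- once.
cos²≡1⇒cross≡0 : ∀ p q r θ κ → ∠ ⟦ p ⟧ , ⟦ q ⟧ , ⟦ r ⟧ is θ → Cos θ is κ → κ * κ ≈ 1ℝ →
                 cross (p ⊖ q) (r ⊖ q) ≡ 0ℚ
cos²≡1⇒cross≡0 p q r θ κ (_ , _ , c , ℓ₁ , ℓ₂ , cosθ , (_ , ℓ₁²) , (_ , ℓ₂²) , prod) cosθ′ κ²≈1 =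
  square≡0 (trans (lagrange (proj₁ A) (proj₂ A) (proj₁ B) (proj₂ B))
    (trans (cong (λ z → dot A A ℚ.* dot B B ℚ.- z) AB²)
           (ℚₚ.+-inverseʳ (dot A A ℚ.* dot B B))))
  where
  A = p ⊖ q
  B = r ⊖ q
  lagrange : ∀ a b c d → (a ℚ.* d ℚ.- b ℚ.* c) ℚ.* (a ℚ.* d ℚ.- b ℚ.* c) ≡
    (a ℚ.* a ℚ.+ b ℚ.* b) ℚ.* (c ℚ.* c ℚ.+ d ℚ.* d) ℚ.-
    (a ℚ.* c ℚ.+ b ℚ.* d) ℚ.* (a ℚ.* c ℚ.+ b ℚ.* d)
  lagrange = solve-∀ ℚ-ring
  c≈κ : c ≈ κ
  c≈κ = ⟶-unique {partialSum (cosTerm θ)} {c} {κ} cosθ cosθ′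
  ℓ = ℓ₁ * ℓ₂ * c
  D = fromℚ (dot A B)
  N₁ = fromℚ (dot A A)
  N₂ = fromℚ (dot B B)
  regroup : ∀ a b c → (a ℚ.* b ℚ.* c) ℚ.* (a ℚ.* b ℚ.* c) ≡ (a ℚ.* a) ℚ.* (b ℚ.* b) ℚ.* (c ℚ.* c)
  regroup = solve-∀ ℚ-ring
  c²≈1 : c * c ≈ 1ℝ
  c²≈1 = ≈-trans {c * c} {κ * κ} {1ℝ} (*-cong {c} {κ} {c} {κ} c≈κ c≈κ) κ²≈1
  D²≈ : D * D ≈ N₁ * N₂ * 1ℝ
  D²≈ = ≈-trans {D * D} {ℓ * ℓ} {N₁ * N₂ * 1ℝ}
    (≈-sym {ℓ * ℓ} {D * D} (*-cong {ℓ} {D} {ℓ} {D} prod prod))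
    (≈-trans {ℓ * ℓ} {(ℓ₁ * ℓ₁) * (ℓ₂ * ℓ₂) * (c * c)} {N₁ * N₂ * 1ℝ}
      (≗⇒≈ {ℓ * ℓ} {(ℓ₁ * ℓ₁) * (ℓ₂ * ℓ₂) * (c * c)} λ n → regroup (seq ℓ₁ n) (seq ℓ₂ n) (seq c n))
      (*-cong {(ℓ₁ * ℓ₁) * (ℓ₂ * ℓ₂)} {N₁ * N₂} {c * c} {1ℝ}
        (*-cong {ℓ₁ * ℓ₁} {N₁} {ℓ₂ * ℓ₂} {N₂} ℓ₁² ℓ₂²) c²≈1))
  AB² : dot A B ℚ.* dot A B ≡ dot A A ℚ.* dot B B
  AB² = trans (x∙y⁻¹≈ε⇒x≈y _ _ (null-const D²≈)) (ℚₚ.*-identityʳ _)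

-- The norms are rescaled by s and t while θ and its cosine c stay the same. Nonnegative s and t
-- keep the rescaled norms nonnegative, as `Norm_is_` demands.
transfer-measure : ∀ p q r p′ q′ r′ s t → 0ℚ ℚ.≤ s → 0ℚ ℚ.≤ t →
  dot (p′ ⊖ q′) (p′ ⊖ q′) ≡ (s ℚ.* s) ℚ.* dot (p ⊖ q) (p ⊖ q) →
  dot (r′ ⊖ q′) (r′ ⊖ q′) ≡ (t ℚ.* t) ℚ.* dot (r ⊖ q) (r ⊖ q) →
  dot (p′ ⊖ q′) (r′ ⊖ q′) ≡ (s ℚ.* t) ℚ.* dot (p ⊖ q) (r ⊖ q) →
  ∀ θ → ∠ ⟦ p ⟧ , ⟦ q ⟧ , ⟦ r ⟧ is θ → ∠ ⟦ p′ ⟧ , ⟦ q′ ⟧ , ⟦ r′ ⟧ is θ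
transfer-measure p q r p′ q′ r′ s t s≥0 t≥0 eqA eqB eqAB θ
  (θ≥0 , θ≤π , c , ℓ₁ , ℓ₂ , cosθ , (ℓ₁≥0 , ℓ₁²) , (ℓ₂≥0 , ℓ₂²) , prod) =
  θ≥0 , θ≤π , c , fromℚ s * ℓ₁ , fromℚ t * ℓ₂ , cosθ ,
  (0≤-scale {x = ℓ₁} s≥0 ℓ₁≥0 , scaled-square s ℓ₁ eqA ℓ₁²) ,
  (0≤-scale {x = ℓ₂} t≥0 ℓ₂≥0 , scaled-square t ℓ₂ eqB ℓ₂²) ,
  null-resp (λ n → trans (distribute-3 s t (seq ℓ₁ n) (seq ℓ₂ n) (seq c n) (dot (p ⊖ q) (r ⊖ q)))
                         (cong (λ z → (s ℚ.* seq ℓ₁ n) ℚ.* (t ℚ.* seq ℓ₂ n) ℚ.* seq c n ℚ.- z) (sym eqAB)))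
            (null-scale (s ℚ.* t) prod)
  where
  distribute-2 : ∀ s ℓ a → (s ℚ.* s) ℚ.* (ℓ ℚ.* ℓ ℚ.- a) ≡
                 (s ℚ.* ℓ) ℚ.* (s ℚ.* ℓ) ℚ.- (s ℚ.* s) ℚ.* a
  distribute-2 = solve-∀ ℚ-ring
  distribute-3 : ∀ s t ℓ m c a → (s ℚ.* t) ℚ.* (ℓ ℚ.* m ℚ.* c ℚ.- a) ≡
                 (s ℚ.* ℓ) ℚ.* (t ℚ.* m) ℚ.* c ℚ.- (s ℚ.* t) ℚ.* a
  distribute-3 = solve-∀ ℚ-ring
  scaled-square : ∀ s ℓ {a a′} → a′ ≡ (s ℚ.* s) ℚ.* a → Null (λ n → seq ℓ n ℚ.* seq ℓ n ℚ.- a) →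
                  Null (λ n → (s ℚ.* seq ℓ n) ℚ.* (s ℚ.* seq ℓ n) ℚ.- a′)
  scaled-square s ℓ {a} refl ℓ² = null-resp (λ n → distribute-2 s (seq ℓ n) a) (null-scale (s ℚ.* s) ℓ²)

¬ignored : ∀ {n} (p : Fin n → ℚ²) i j k → cross (p i ⊖ p j) (p k ⊖ p j) ≢ 0ℚ →
           ¬ Ignored (⟦_⟧ ∘ p) (angle i j k)
¬ignored p i j k ≢0 (inj₁ is0) =
  ≢0 (cos²≡1⇒cross≡0 (p i) (p j) (p k) 0ℝ 1ℝ is0 cos0 (≗⇒≈ {1ℝ * 1ℝ} {1ℝ} λ _ → refl))
¬ignored p i j k ≢0 (inj₂ (π , (_ , cosπ , _) , isπ)) =
  ≢0 (cos²≡1⇒cross≡0 (p i) (p j) (p k) π (- 1ℝ) isπ cosπ (≗⇒≈ {(- 1ℝ) * (- 1ℝ)} {1ℝ} λ _ → refl))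

-- Counting angles

enum : ∀ {n} (Q : Subset n) → Fin ∣ Q ∣ → Fin n
enum (outside ∷ Q) i       = suc (enum Q i)
enum (inside  ∷ Q) zero    = zero
enum (inside  ∷ Q) (suc i) = suc (enum Q i)

enum-∈ : ∀ {n} (Q : Subset n) i → enum Q i ∈ Q
enum-∈ (outside ∷ Q) i       = there (enum-∈ Q i)
enum-∈ (inside  ∷ Q) zero    = here
enum-∈ (inside  ∷ Q) (suc i) = there (enum-∈ Q i)

enum-mono-< : ∀ {n} (Q : Subset n) {i j} → i Fin.< j → enum Q i Fin.< enum Q j
enum-mono-< (outside ∷ Q) i<j                               = s≤s (enum-mono-< Q i<j)
enum-mono-< (inside  ∷ Q) {zero}  {suc j} i<j       = s≤s z≤n
enum-mono-< (inside  ∷ Q) {suc i} {suc j} (s≤s i<j) = s≤s (enum-mono-< Q i<j)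

enum-injective : ∀ {n} (Q : Subset n) {i j} → enum Q i ≡ enum Q j → i ≡ j
enum-injective (outside ∷ Q) {i}     {j}     eq = enum-injective Q (Finₚ.suc-injective eq)
enum-injective (inside  ∷ Q) {zero}  {zero}  eq = refl
enum-injective (inside  ∷ Q) {suc i} {suc j} eq =
  cong suc (enum-injective Q (Finₚ.suc-injective eq))

injective₃⇒≤ : ∀ {h M} (f : Fin h → Fin h → Fin h → Fin M) →
  (∀ {a b c a′ b′ c′} → f a b c ≡ f a′ b′ c′ → a ≡ a′ × b ≡ b′ × c ≡ c′) →
  h ℕ.* (h ℕ.* h) ℕ.≤ M
injective₃⇒≤ {h} f inj = injective⇒≤ {f = g} g-injective
  where
  a b c : Fin (h ℕ.* (h ℕ.* h)) → Fin h
  a x = proj₁ (remQuot {h} (h ℕ.* h) x)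
  b x = proj₁ (remQuot {h} h (proj₂ (remQuot {h} (h ℕ.* h) x)))
  c x = proj₂ (remQuot {h} h (proj₂ (remQuot {h} (h ℕ.* h) x)))
  g : Fin (h ℕ.* (h ℕ.* h)) → Fin _
  g x = f (a x) (b x) (c x)
  rebuild : ∀ x → combine (a x) (combine (b x) (c x)) ≡ x
  rebuild x = trans (cong (combine (a x)) (combine-remQuot {h} h _))
                    (combine-remQuot {h} (h ℕ.* h) x)
  g-injective : Injective _≡_ _≡_ g
  g-injective {x} {y} eq with inj eq
  ... | a≡ , b≡ , c≡ = trans (sym (rebuild x))
    (trans (cong₂ combine a≡ (cong₂ combine b≡ c≡)) (rebuild y))

-- For h ≥ 1 one has 3h + 2 ≤ 5h, which gives 125 = 5³; for h = 0 at most two points are left, and 8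
-- ≤ 125.
cube-≤ : ∀ {m h M} → 1 ℕ.≤ M → m ℕ.≤ 2 ℕ.+ h ℕ.* 3 → h ℕ.* (h ℕ.* h) ℕ.≤ M →
         m ℕ.^ 3 ℕ.≤ 125 ℕ.* M
cube-≤ {m} {zero} {M} 1≤M m≤ _ = begin
  m ℕ.^ 3      ≤⟨ ℕₚ.^-monoˡ-≤ 3 m≤ ⟩
  8            ≤⟨ ℕₚ.m≤m+n 8 117 ⟩
  125 ℕ.* 1    ≤⟨ ℕₚ.*-monoʳ-≤ 125 1≤M ⟩
  125 ℕ.* M    ∎
  where open ℕₚ.≤-Reasoning
cube-≤ {m} {suc h} {M} _ m≤ h³≤M = begin
  m ℕ.^ 3                                      ≤⟨ ℕₚ.^-monoˡ-≤ 3 m≤5h ⟩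
  (5 ℕ.* suc h) ℕ.^ 3                          ≡⟨ expand (suc h) ⟩
  125 ℕ.* (suc h ℕ.* (suc h ℕ.* suc h))        ≤⟨ ℕₚ.*-monoʳ-≤ 125 h³≤M ⟩
  125 ℕ.* M                                    ∎
  where
  open ℕₚ.≤-Reasoning
  open +-*-Solver
  expand : ∀ x → (5 ℕ.* x) ℕ.^ 3 ≡ 125 ℕ.* (x ℕ.* (x ℕ.* x))
  expand = solve 1 (λ x → (con 5 :* x) :^ 3 := con 125 :* (x :* (x :* x))) refl
  slack : ∀ x → 2 ℕ.+ (1 ℕ.+ x) ℕ.* 3 ℕ.+ 2 ℕ.* x ≡ 5 ℕ.* (1 ℕ.+ x)
  slack = solve 1 (λ x → con 2 :+ (con 1 :+ x) :* con 3 :+ con 2 :* x := con 5 :* (con 1 :+ x)) refl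
  m≤5h : m ℕ.≤ 5 ℕ.* suc h
  m≤5h = ℕₚ.≤-trans m≤ (subst (2 ℕ.+ suc h ℕ.* 3 ℕ.≤_) (slack h) (ℕₚ.m≤m+n _ (2 ℕ.* h)))

-- Splitting Q, in increasing order, into three blocks of h = ⌊|Q|/3⌋ points
-- gives h³ angles with their endpoints in the outer blocks and their centre in
-- the middle one.
few-classes⇒small : ∀ {n M} (p : Fin n → ℚ²) (class : Fin n → Fin n → Fin n → Fin M) →
  1 ℕ.≤ M →
  (∀ i j k → i Fin.< j → j Fin.< k → orient (p j) (p i) (p k) ≢ 0ℚ) →
  (∀ i j k i′ j′ k′ → i Fin.< j → j Fin.< k → i′ Fin.< j′ → j′ Fin.< k′ →
     class i j k ≡ class i′ j′ k′ →
     EqualMeasure (⟦_⟧ ∘ p) (angle i j k) (angle i′ j′ k′)) →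
  ∀ Q → NoRepeatedAngle (⟦_⟧ ∘ p) Q → ∣ Q ∣ ℕ.^ 3 ℕ.≤ 125 ℕ.* M
few-classes⇒small p class 1≤M ≢0 sameClass Q noRep =
  cube-≤ {h = h} 1≤M m≤ (injective₃⇒≤ (λ a b c → class (left a) (mid b) (right c)) class-injective)
  where
  m = ∣ Q ∣
  h = m ℕ./ 3
  m≤ : m ℕ.≤ 2 ℕ.+ h ℕ.* 3
  m≤ = subst (ℕ._≤ 2 ℕ.+ h ℕ.* 3) (sym (m≡m%n+[m/n]*n m 3))
         (ℕₚ.+-monoˡ-≤ (h ℕ.* 3) (ℕ.s≤s⁻¹ (m%n<n m 3)))
  3h≤m : h ℕ.+ (h ℕ.+ h) ℕ.≤ m
  3h≤m = subst (ℕ._≤ m) (thrice h) (m/n*n≤m m 3)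
    where
    open +-*-Solver
    thrice : ∀ x → x ℕ.* 3 ≡ x ℕ.+ (x ℕ.+ x)
    thrice = solve 1 (λ x → x :* con 3 := x :+ (x :+ x)) refl
  slot : ∀ o → o ℕ.+ h ℕ.≤ m → Fin h → Fin m
  slot o le a = inject≤ (o ↑ʳ a) le
  toℕ-slot : ∀ o le a → toℕ (slot o le a) ≡ o ℕ.+ toℕ a
  toℕ-slot o le a = trans (toℕ-inject≤ (o ↑ʳ a) le) (toℕ-↑ʳ o a)
  slot-injective : ∀ o le {a b} → slot o le a ≡ slot o le b → a ≡ b
  slot-injective o le {a} {b} eq = Finₚ.toℕ-injective (ℕₚ.+-cancelˡ-≡ o (toℕ a) (toℕ b)
    (trans (sym (toℕ-slot o le a)) (trans (cong toℕ eq) (toℕ-slot o le b))))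
  slot-< : ∀ o le o′ le′ → o ℕ.+ h ℕ.≤ o′ → ∀ a b → slot o le a Fin.< slot o′ le′ b
  slot-< o le o′ le′ gap a b = subst₂ ℕ._<_ (sym (toℕ-slot o le a)) (sym (toℕ-slot o′ le′ b))
    (ℕₚ.<-≤-trans (ℕₚ.+-monoʳ-< o (toℕ<n a)) (ℕₚ.≤-trans gap (ℕₚ.m≤m+n o′ (toℕ b))))
  le₀ : 0 ℕ.+ h ℕ.≤ m
  le₀ = ℕₚ.≤-trans (ℕₚ.m≤m+n h (h ℕ.+ h)) 3h≤m
  le₁ : h ℕ.+ h ℕ.≤ m
  le₁ = ℕₚ.≤-trans (ℕₚ.m≤n+m (h ℕ.+ h) h) 3h≤m
  le₂ : (h ℕ.+ h) ℕ.+ h ℕ.≤ m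
  le₂ = subst (ℕ._≤ m) (sym (ℕₚ.+-assoc h h h)) 3h≤m
  left mid right : Fin h → Fin _
  left  a = enum Q (slot 0 le₀ a)
  mid   a = enum Q (slot h le₁ a)
  right a = enum Q (slot (h ℕ.+ h) le₂ a)
  left<mid : ∀ a b → left a Fin.< mid b
  left<mid a b = enum-mono-< Q (slot-< 0 le₀ h le₁ ℕₚ.≤-refl a b)
  mid<right : ∀ a b → mid a Fin.< right b
  mid<right a b = enum-mono-< Q (slot-< h le₁ (h ℕ.+ h) le₂ ℕₚ.≤-refl a b)
  angle∈ : ∀ a b c → angle (left a) (mid b) (right c) ∈∠ Q
  angle∈ a b c = record
    { end₁∈   = enum-∈ Q _
    ; centre∈ = enum-∈ Q _
    ; end₂∈   = enum-∈ Q _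
    ; end₁<   = Finₚ.<-trans (left<mid a b) (mid<right b c)
    ; end₁≢   = Finₚ.<⇒≢ (left<mid a b)
    ; end₂≢   = ≢-sym (Finₚ.<⇒≢ (mid<right b c))
    }
  proper : ∀ a b c → ¬ Ignored (⟦_⟧ ∘ p) (angle (left a) (mid b) (right c))
  proper a b c = ¬ignored p (left a) (mid b) (right c)
    (≢0 (left a) (mid b) (right c) (left<mid a b) (mid<right b c))
  class-injective : ∀ {a b c a′ b′ c′} →
    class (left a) (mid b) (right c) ≡ class (left a′) (mid b′) (right c′) →
    a ≡ a′ × b ≡ b′ × c ≡ c′
  class-injective {a} {b} {c} {a′} {b′} {c′} eq =
    slot-injective 0 le₀ (enum-injective Q (cong AngleIndex.end₁ same)) ,
    slot-injective h le₁ (enum-injective Q (cong AngleIndex.centre same)) ,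
    slot-injective (h ℕ.+ h) le₂ (enum-injective Q (cong AngleIndex.end₂ same))
    where
    same = noRep _ _ (angle∈ a b c) (angle∈ a′ b′ c′) (proper a b c) (proper a′ b′ c′)
      (sameClass _ _ _ _ _ _ (left<mid a b) (mid<right b c) (left<mid a′ b′) (mid<right b′ c′) eq)

-- Extrema up to double negation, and reduction to one configuration for each n

¬¬-minimum : ∀ (S : ℕ → Set) → ¬ ¬ (∃[ m ] S m) → ¬ ¬ (∃[ m ] (S m × (∀ k → S k → m ℕ.≤ k)))
¬¬-minimum S ¬¬S noMin = ¬¬S λ (m , Sm) → none m Sm
  where
  none : ∀ m → ¬ S m
  -- If nothing below m lies in `S`, then m is a minimum, which `noMin` forbids.
  none = <-rec _ λ m below Sm →
    noMin (m , Sm , λ k Sk → ℕₚ.≮⇒≥ λ k<m → below k<m Sk)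

-- Starting from the empty subset, a set that is not of maximal size is replaced by a larger one.
-- The invariant n ≤ |Q| + fuel ends the climb, since at fuel 0 the set Q is as large as possible.
¬¬-R : ∀ {n} (P : Points n) → ¬ ¬ (∃[ k ] R[ P ]≡ k)
¬¬-R {n} P noMax = climb n Subset.⊥ (λ α _ α∈ → ⊥-elim (∉⊥ (_∈∠_.end₁∈ α∈)))
    (ℕₚ.m≤n+m n ∣ Subset.⊥ {n} ∣)
  where
  climb : ∀ fuel Q → NoRepeatedAngle P Q → ¬ (n ℕ.≤ ∣ Q ∣ ℕ.+ fuel)
  climb zero Q noRep n≤ = noMax (∣ Q ∣ , (Q , noRep , refl) , λ Q′ _ →
    ℕₚ.≤-trans (∣p∣≤n Q′) (subst (n ℕ.≤_) (ℕₚ.+-identityʳ ∣ Q ∣) n≤))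
  climb (suc fuel) Q noRep n≤ = noMax (∣ Q ∣ , (Q , noRep , refl) , λ Q′ noRep′ →
    ℕₚ.≮⇒≥ λ Q<Q′ → climb fuel Q′ noRep′
      (ℕₚ.≤-trans (subst (n ℕ.≤_) (ℕₚ.+-suc ∣ Q ∣ fuel) n≤) (ℕₚ.+-monoˡ-≤ fuel Q<Q′)))

-- A minimum is bounded above by any single value, so one good configuration per n suffices; the
-- same configuration shows that the set of values is inhabited, up to double negation.
witness⇒isO : ∀ (𝒞 : PointClass) e C N →
  (∀ n → N ℕ.≤ n → Σ (Points n) λ P → Admissible 𝒞 P ×
     (∀ Q → NoRepeatedAngle P Q → ∣ Q ∣ ≤ C · n ^ₑ e)) →
  MinR 𝒞 isO[n^ e ]
witness⇒isO 𝒞 e C N family = C , N , λ n N≤n → defined n N≤n , bound n N≤n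
  where
  Attained : ℕ → ℕ → Set
  Attained n k = Σ (Points n) λ P → Admissible 𝒞 P × R[ P ]≡ k
  defined : ∀ n → N ℕ.≤ n → ¬ ¬ (∃[ m ] MinR 𝒞 n m)
  defined n N≤n noMin =
    let P , adm , _ = family n N≤n
    in ¬¬-minimum (Attained n) (λ ¬S → ¬¬-R P λ (k , RPk) → ¬S (k , P , adm , RPk))
         λ (m , attained , least) → noMin (m , attained , λ P′ k adm′ RP′k → least k (P′ , adm′ , RP′k))
  bound : ∀ n → N ℕ.≤ n → ∀ m → MinR 𝒞 n m → m ≤ C · n ^ₑ e
  bound n N≤n m (_ , least) p q q>0 e<p/q =
    let P , adm , small = family n N≤n
    -- The goal is a comparison of natural numbers, hence stable, so the value R(P) may be used
    -- although it is only known to exist up to double negation.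
    in decidable-stable (m ℕ.^ q ℕₚ.≤? C ℕ.^ q ℕ.* n ℕ.^ p) λ ¬le →
         ¬¬-R P λ (k , (Q , noRep , ∣Q∣≡k) , maximal) →
           ¬le (ℕₚ.≤-trans
             (ℕₚ.^-monoˡ-≤ q (subst (m ℕ.≤_) (sym ∣Q∣≡k)
               (least P k adm ((Q , noRep , ∣Q∣≡k) , maximal))))
             (small Q noRep p q q>0 e<p/q))

-- Exponents and cube roots of natural numbers

^-distribʳ-* : ∀ o m n → (m ℕ.* n) ℕ.^ o ≡ m ℕ.^ o ℕ.* n ℕ.^ o
^-distribʳ-* zero    m n = refl
^-distribʳ-* (suc o) m n = trans (cong (m ℕ.* n ℕ.*_) (^-distribʳ-* o m n))
  (ℕₚ.[m*n]*[o*p]≡[m*o]*[n*p] m n (m ℕ.^ o) (n ℕ.^ o))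

^-swap : ∀ b i j → (b ℕ.^ i) ℕ.^ j ≡ (b ℕ.^ j) ℕ.^ i
^-swap b i j = trans (ℕₚ.^-*-assoc b i j)
  (trans (cong (b ℕ.^_) (ℕₚ.*-comm i j)) (sym (ℕₚ.^-*-assoc b j i)))

cube-root-≤ : ∀ {x y} → x ℕ.^ 3 ℕ.≤ y ℕ.^ 3 → x ℕ.≤ y
cube-root-≤ {x} {y} x³≤y³ = ℕₚ.≮⇒≥ λ y<x → ℕₚ.<⇒≱ (ℕₚ.^-monoˡ-< 3 y<x) x³≤y³

-- Roots are avoided by comparing the cubes of both sides; 1000 = 10³ then becomes the constant 10.
root-bound : ∀ {m n M} p q → m ℕ.^ 3 ℕ.≤ 1000 ℕ.* M → M ℕ.^ q ℕ.≤ n ℕ.^ (3 ℕ.* p) →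
             m ℕ.^ q ℕ.≤ 10 ℕ.^ q ℕ.* n ℕ.^ p
root-bound {m} {n} {M} p q m³≤ M^q≤ = cube-root-≤ (begin
  (m ℕ.^ q) ℕ.^ 3                        ≡⟨ ^-swap m q 3 ⟩
  (m ℕ.^ 3) ℕ.^ q                        ≤⟨ ℕₚ.^-monoˡ-≤ q m³≤ ⟩
  (10 ℕ.^ 3 ℕ.* M) ℕ.^ q                 ≡⟨ ^-distribʳ-* q (10 ℕ.^ 3) M ⟩
  (10 ℕ.^ 3) ℕ.^ q ℕ.* M ℕ.^ q           ≤⟨ ℕₚ.*-monoʳ-≤ ((10 ℕ.^ 3) ℕ.^ q) M^q≤ ⟩
  (10 ℕ.^ 3) ℕ.^ q ℕ.* n ℕ.^ (3 ℕ.* p)   ≡⟨ cong₂ ℕ._*_ (^-swap 10 3 q) (cong (n ℕ.^_) (ℕₚ.*-comm 3 p)) ⟩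
  (10 ℕ.^ q) ℕ.^ 3 ℕ.* n ℕ.^ (p ℕ.* 3)   ≡⟨ cong ((10 ℕ.^ q) ℕ.^ 3 ℕ.*_) (sym (ℕₚ.^-*-assoc n p 3)) ⟩
  (10 ℕ.^ q) ℕ.^ 3 ℕ.* (n ℕ.^ p) ℕ.^ 3   ≡⟨ sym (^-distribʳ-* 3 (10 ℕ.^ q) (n ℕ.^ p)) ⟩
  (10 ℕ.^ q ℕ.* n ℕ.^ p) ℕ.^ 3           ∎)
  where
  open ℕₚ.≤-Reasoning

-- Powers of a rational point of the unit circle

infixl 7 _⊗_
_⊗_ : ℚ² → ℚ² → ℚ²
(a , b) ⊗ (c , d) = a ℚ.* c ℚ.- b ℚ.* d , a ℚ.* d ℚ.+ b ℚ.* c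

conj : ℚ² → ℚ²
conj (a , b) = a , ℚ.- b

⊗-assoc : ∀ x y z → (x ⊗ y) ⊗ z ≡ x ⊗ (y ⊗ z)
⊗-assoc (a , b) (c , d) (e , f) = cong₂ _,_ (re a b c d e f) (im a b c d e f)
  where
  re : ∀ a b c d e f → (a ℚ.* c ℚ.- b ℚ.* d) ℚ.* e ℚ.- (a ℚ.* d ℚ.+ b ℚ.* c) ℚ.* f ≡
       a ℚ.* (c ℚ.* e ℚ.- d ℚ.* f) ℚ.- b ℚ.* (c ℚ.* f ℚ.+ d ℚ.* e)
  re = solve-∀ ℚ-ring
  im : ∀ a b c d e f → (a ℚ.* c ℚ.- b ℚ.* d) ℚ.* f ℚ.+ (a ℚ.* d ℚ.+ b ℚ.* c) ℚ.* e ≡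
       a ℚ.* (c ℚ.* f ℚ.+ d ℚ.* e) ℚ.+ b ℚ.* (c ℚ.* e ℚ.- d ℚ.* f)
  im = solve-∀ ℚ-ring

⊗-identityˡ : ∀ x → (1ℚ , 0ℚ) ⊗ x ≡ x
⊗-identityˡ (a , b) = cong₂ _,_ (re a b) (im a b)
  where
  re : ∀ a b → 1ℚ ℚ.* a ℚ.- 0ℚ ℚ.* b ≡ a
  re = solve-∀ ℚ-ring
  im : ∀ a b → 1ℚ ℚ.* b ℚ.+ 0ℚ ℚ.* a ≡ b
  im = solve-∀ ℚ-ring

-- Read (a , b) as a + bi. Then `dot α β` and `cross α β` are the real and imaginary parts of ᾱβ,
-- and multiplying both arguments by x scales this product by |x|².
dot-⊗ : ∀ x α β → dot (x ⊗ α) (x ⊗ β) ≡ dot x x ℚ.* dot α β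
dot-⊗ (a , b) (c , d) (e , f) = identity a b c d e f
  where
  identity : ∀ a b c d e f →
    (a ℚ.* c ℚ.- b ℚ.* d) ℚ.* (a ℚ.* e ℚ.- b ℚ.* f) ℚ.+ (a ℚ.* d ℚ.+ b ℚ.* c) ℚ.* (a ℚ.* f ℚ.+ b ℚ.* e) ≡
    (a ℚ.* a ℚ.+ b ℚ.* b) ℚ.* (c ℚ.* e ℚ.+ d ℚ.* f)
  identity = solve-∀ ℚ-ring

cross-⊗ : ∀ x α β → cross (x ⊗ α) (x ⊗ β) ≡ dot x x ℚ.* cross α β
cross-⊗ (a , b) (c , d) (e , f) = identity a b c d e f
  where
  identity : ∀ a b c d e f →
    (a ℚ.* c ℚ.- b ℚ.* d) ℚ.* (a ℚ.* f ℚ.+ b ℚ.* e) ℚ.- (a ℚ.* d ℚ.+ b ℚ.* c) ℚ.* (a ℚ.* e ℚ.- b ℚ.* f) ≡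
    (a ℚ.* a ℚ.+ b ℚ.* b) ℚ.* (c ℚ.* f ℚ.- d ℚ.* e)
  identity = solve-∀ ℚ-ring

⊗-conj : ∀ x y → dot y y ≡ 1ℚ → (x ⊗ y) ⊗ conj y ≡ x
⊗-conj (a , b) (c , d) unit = cong₂ _,_
  (trans (re a b c d) (trans (cong (a ℚ.*_) unit) (ℚₚ.*-identityʳ a)))
  (trans (im a b c d) (trans (cong (b ℚ.*_) unit) (ℚₚ.*-identityʳ b)))
  where
  re : ∀ a b c d → (a ℚ.* c ℚ.- b ℚ.* d) ℚ.* c ℚ.- (a ℚ.* d ℚ.+ b ℚ.* c) ℚ.* (ℚ.- d) ≡
       a ℚ.* (c ℚ.* c ℚ.+ d ℚ.* d)
  re = solve-∀ ℚ-ring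
  im : ∀ a b c d → (a ℚ.* c ℚ.- b ℚ.* d) ℚ.* (ℚ.- d) ℚ.+ (a ℚ.* d ℚ.+ b ℚ.* c) ℚ.* c ≡
       b ℚ.* (c ℚ.* c ℚ.+ d ℚ.* d)
  im = solve-∀ ℚ-ring

-- For |y| = 1 this is y² − 1 = y (y − ȳ) = 2i Im(y) y.
chord : ℚ² → ℚ²
chord (c , d) = ℚ.- ((d ℚ.+ d) ℚ.* d) , (d ℚ.+ d) ℚ.* c

square-⊖ : ∀ x y → dot y y ≡ 1ℚ → (x ⊗ y) ⊗ (x ⊗ y) ⊖ x ⊗ x ≡ (x ⊗ x) ⊗ chord y
square-⊖ (a , b) (c , d) unit = cong₂ _,_
  (trans (re a b c d) (vanish (a ℚ.* a ℚ.- b ℚ.* b)))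
  (trans (im a b c d) (vanish (a ℚ.* b ℚ.+ b ℚ.* a)))
  where
  -- The identities `re` and `im` hold for all y up to a multiple z of |y|² - 1; this removes that
  -- multiple.
  vanish : ∀ {e} z → e ℚ.+ z ℚ.* ((c ℚ.* c ℚ.+ d ℚ.* d) ℚ.- 1ℚ) ≡ e
  vanish {e} z = trans (cong (λ n → e ℚ.+ z ℚ.* (n ℚ.- 1ℚ)) unit)
    (trans (cong (e ℚ.+_) (ℚₚ.*-zeroʳ z)) (ℚₚ.+-identityʳ e))
  re : ∀ a b c d →
    ((a ℚ.* c ℚ.- b ℚ.* d) ℚ.* (a ℚ.* c ℚ.- b ℚ.* d) ℚ.- (a ℚ.* d ℚ.+ b ℚ.* c) ℚ.* (a ℚ.* d ℚ.+ b ℚ.* c))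
      ℚ.- (a ℚ.* a ℚ.- b ℚ.* b) ≡
    ((a ℚ.* a ℚ.- b ℚ.* b) ℚ.* (ℚ.- ((d ℚ.+ d) ℚ.* d)) ℚ.- (a ℚ.* b ℚ.+ b ℚ.* a) ℚ.* ((d ℚ.+ d) ℚ.* c))
      ℚ.+ (a ℚ.* a ℚ.- b ℚ.* b) ℚ.* ((c ℚ.* c ℚ.+ d ℚ.* d) ℚ.- 1ℚ)
  re = solve-∀ ℚ-ring
  im : ∀ a b c d →
    ((a ℚ.* c ℚ.- b ℚ.* d) ℚ.* (a ℚ.* d ℚ.+ b ℚ.* c) ℚ.+ (a ℚ.* d ℚ.+ b ℚ.* c) ℚ.* (a ℚ.* c ℚ.- b ℚ.* d))
      ℚ.- (a ℚ.* b ℚ.+ b ℚ.* a) ≡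
    ((a ℚ.* a ℚ.- b ℚ.* b) ℚ.* ((d ℚ.+ d) ℚ.* c) ℚ.+ (a ℚ.* b ℚ.+ b ℚ.* a) ℚ.* (ℚ.- ((d ℚ.+ d) ℚ.* d)))
      ℚ.+ (a ℚ.* b ℚ.+ b ℚ.* a) ℚ.* ((c ℚ.* c ℚ.+ d ℚ.* d) ℚ.- 1ℚ)
  im = solve-∀ ℚ-ring

-- The configuration consists of the even powers of `ω`. Halving the arcs, as the inscribed angle
-- theorem does, leads back to powers of `ω`, so chord lengths and the cosines of the angles are all
-- rational.
ω : ℚ²
ω = (+ 3) ℚ./ 5 , (+ 4) ℚ./ 5

rot : ℕ → ℚ²
rot zero    = 1ℚ , 0ℚ
rot (suc m) = ω ⊗ rot m

rot-+ : ∀ m n → rot (m ℕ.+ n) ≡ rot m ⊗ rot n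
rot-+ zero    n = sym (⊗-identityˡ (rot n))
rot-+ (suc m) n = trans (cong (ω ⊗_) (rot-+ m n)) (sym (⊗-assoc ω (rot m) (rot n)))

rot-unit : ∀ m → dot (rot m) (rot m) ≡ 1ℚ
rot-unit zero    = refl
rot-unit (suc m) = trans (dot-⊗ ω (rot m) (rot m)) (cong₂ ℚ._*_ {dot ω ω} {1ℚ} refl (rot-unit m))

-- Congruences modulo 5: `ω` has infinite order

fromℤ : ℤ → ℚ
fromℤ z = ℚ.mkℚ z 0 (Coprime.sym (1-coprimeTo ℤ.∣ z ∣))

fromℤ-+ : ∀ x y → fromℤ (x ℤ.+ y) ≡ fromℤ x ℚ.+ fromℤ y
fromℤ-+ x y = ℚₚ.toℚᵘ-injective (ℚᵘₚ.≃-trans (*≡* (identity x y))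
  (ℚᵘₚ.≃-sym (ℚₚ.toℚᵘ-homo-+ (fromℤ x) (fromℤ y))))
  where
  identity : ∀ x y → (x ℤ.+ y) ℤ.* ℤ.1ℤ ≡ (x ℤ.* ℤ.1ℤ ℤ.+ y ℤ.* ℤ.1ℤ) ℤ.* ℤ.1ℤ
  identity = ℤ-Solver.solve-∀

fromℤ-* : ∀ x y → fromℤ (x ℤ.* y) ≡ fromℤ x ℚ.* fromℤ y
fromℤ-* x y = ℚₚ.toℚᵘ-injective
  (ℚᵘₚ.≃-sym (ℚₚ.toℚᵘ-homo-* (fromℤ x) (fromℤ y)))

-- (3 + 4i)² ≡ 3 + 4i modulo 5, hence so is every positive power of 3 + 4i.
Mod5 : ℚ² → Set
Mod5 (c , s) = ∃[ D ] ∃[ a ] ∃[ b ]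
  (D ℚ.* c ≡ fromℤ (+ 3 ℤ.+ + 5 ℤ.* a) × D ℚ.* s ≡ fromℤ (+ 4 ℤ.+ + 5 ℤ.* b))

fromℤ-lin : ∀ k x l y → fromℤ (k ℤ.* x ℤ.+ l ℤ.* y) ≡
            fromℤ k ℚ.* fromℤ x ℚ.+ fromℤ l ℚ.* fromℤ y
fromℤ-lin k x l y = trans (fromℤ-+ (k ℤ.* x) (l ℤ.* y)) (cong₂ ℚ._+_ (fromℤ-* k x) (fromℤ-* l y))

rot-mod5 : ∀ m → Mod5 (rot (suc m))
rot-mod5 zero = fromℤ (+ 5) , + 0 , + 0 , refl , refl
rot-mod5 (suc m) with rot-mod5 m
... | D , a , b , Dc , Ds =
  fromℤ (+ 5) ℚ.* D ,
  -- Multiplication by 3 + 4i: the constant terms are 9 - 16 = 3 + 5 · (-2) and 12 + 12 = 4 + 5 · 4.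
  -- The multiplier D is a power of 5 that clears the denominators.
  -[1+ 1 ] ℤ.+ + 3 ℤ.* a ℤ.+ -[1+ 3 ] ℤ.* b ,
  + 4 ℤ.+ + 3 ℤ.* b ℤ.+ + 4 ℤ.* a ,
  trans (scale-re (fromℤ (+ 5)) D (proj₁ ω) (proj₂ ω) c s)
    (trans (cong₂ (λ u v → fromℤ (+ 3) ℚ.* u ℚ.+ fromℤ -[1+ 3 ] ℚ.* v) Dc Ds)
      (trans (sym (fromℤ-lin (+ 3) a′ -[1+ 3 ] b′)) (cong fromℤ (re a b)))) ,
  trans (scale-im (fromℤ (+ 5)) D (proj₁ ω) (proj₂ ω) c s)
    (trans (cong₂ (λ u v → fromℤ (+ 3) ℚ.* u ℚ.+ fromℤ (+ 4) ℚ.* v) Ds Dc)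
      (trans (sym (fromℤ-lin (+ 3) b′ (+ 4) a′)) (cong fromℤ (im a b))))
  where
  c = proj₁ (rot (suc m))
  s = proj₂ (rot (suc m))
  a′ = + 3 ℤ.+ + 5 ℤ.* a
  b′ = + 4 ℤ.+ + 5 ℤ.* b
  scale-re : ∀ f D x y c s → (f ℚ.* D) ℚ.* (x ℚ.* c ℚ.- y ℚ.* s) ≡
             (f ℚ.* x) ℚ.* (D ℚ.* c) ℚ.+ (ℚ.- (f ℚ.* y)) ℚ.* (D ℚ.* s)
  scale-re = solve-∀ ℚ-ring
  scale-im : ∀ f D x y c s → (f ℚ.* D) ℚ.* (x ℚ.* s ℚ.+ y ℚ.* c) ≡
             (f ℚ.* x) ℚ.* (D ℚ.* s) ℚ.+ (f ℚ.* y) ℚ.* (D ℚ.* c)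
  scale-im = solve-∀ ℚ-ring
  re : ∀ a b → + 3 ℤ.* (+ 3 ℤ.+ + 5 ℤ.* a) ℤ.+ -[1+ 3 ] ℤ.* (+ 4 ℤ.+ + 5 ℤ.* b) ≡
       + 3 ℤ.+ + 5 ℤ.* (-[1+ 1 ] ℤ.+ + 3 ℤ.* a ℤ.+ -[1+ 3 ] ℤ.* b)
  re = ℤ-Solver.solve-∀
  im : ∀ a b → + 3 ℤ.* (+ 4 ℤ.+ + 5 ℤ.* b) ℤ.+ + 4 ℤ.* (+ 3 ℤ.+ + 5 ℤ.* a) ≡
       + 4 ℤ.+ + 5 ℤ.* (+ 4 ℤ.+ + 3 ℤ.* b ℤ.+ + 4 ℤ.* a)
  im = ℤ-Solver.solve-∀

sin cos : ℕ → ℚ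
cos m = proj₁ (rot m)
sin m = proj₂ (rot m)

4+5b≢0 : ∀ b → + 4 ℤ.+ + 5 ℤ.* b ≢ + 0
4+5b≢0 b eq = no-multiple ℤ.∣ b ∣ (begin
  ℤ.∣ b ∣ ℕ.* 5             ≡⟨ ℕₚ.*-comm ℤ.∣ b ∣ 5 ⟩
  5 ℕ.* ℤ.∣ b ∣             ≡⟨ sym (ℤₚ.abs-* (+ 5) b) ⟩
  ℤ.∣ + 5 ℤ.* b ∣           ≡⟨ cong ℤ.∣_∣ (subtract-4 (+ 5 ℤ.* b)) ⟩
  ℤ.∣ -[1+ 3 ] ℤ.+ (+ 4 ℤ.+ + 5 ℤ.* b) ∣ ≡⟨ cong (λ z → ℤ.∣ -[1+ 3 ] ℤ.+ z ∣) eq ⟩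
  4                         ∎)
  where
  open ≡-Reasoning
  subtract-4 : ∀ z → z ≡ -[1+ 3 ] ℤ.+ (+ 4 ℤ.+ z)
  subtract-4 = ℤ-Solver.solve-∀
  no-multiple : ∀ k → k ℕ.* 5 ≢ 4
  no-multiple zero    ()
  no-multiple (suc k) ()

-- After clearing denominators the imaginary part is 4 modulo 5. So no positive power of `ω` is
-- real, which yields both the distinctness of the points and the nondegeneracy of their angles.
sin≢0 : ∀ m → sin (suc m) ≢ 0ℚ
sin≢0 m sin≡0 with rot-mod5 m
-- `fromℤ` is built with the constructor of ℚ, so `ℚ.numerator` returns the integer by computation.
... | D , _ , b , _ , Ds = 4+5b≢0 b (cong ℚ.numerator
  (trans (sym Ds) (trans (cong (D ℚ.*_) sin≡0) (ℚₚ.*-zeroʳ D))))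

-- The inscribed angle theorem

circlePoint : ℕ → ℚ²
circlePoint m = rot m ⊗ rot m

sin₂ : ℕ → ℚ
sin₂ m = sin m ℚ.+ sin m

sin₂≢0 : ∀ {m} → 0 ℕ.< m → sin₂ m ≢ 0ℚ
sin₂≢0 {suc m} _ eq = sin≢0 m (*-cancelˡ-≢0 {1ℚ ℚ.+ 1ℚ} {sin (suc m)} (λ ()) (trans (double (sin (suc m))) eq))
  where
  double : ∀ x → (1ℚ ℚ.+ 1ℚ) ℚ.* x ≡ x ℚ.+ x
  double = solve-∀ ℚ-ring

conj-unit : ∀ y → dot y y ≡ 1ℚ → dot (conj y) (conj y) ≡ 1ℚ
conj-unit (c , d) unit = trans (identity c d) unit
  where
  identity : ∀ c d → c ℚ.* c ℚ.+ (ℚ.- d) ℚ.* (ℚ.- d) ≡ c ℚ.* c ℚ.+ d ℚ.* d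
  identity = solve-∀ ℚ-ring

-- The legs at j = i + a are written as `circlePoint j` times a chord that depends only on a gap,
-- here taken with ω⁻ᵃ, the conjugate of ωᵃ. The common unit factor then drops out of all scalar
-- products.
backward : ∀ i a → circlePoint i ⊖ circlePoint (i ℕ.+ a) ≡ circlePoint (i ℕ.+ a) ⊗ chord (conj (rot a))
backward i a = trans (cong (λ z → z ⊗ z ⊖ circlePoint (i ℕ.+ a)) back)
  (square-⊖ (rot (i ℕ.+ a)) (conj (rot a)) (conj-unit (rot a) (rot-unit a)))
  where
  back : rot i ≡ rot (i ℕ.+ a) ⊗ conj (rot a)
  back = trans (sym (⊗-conj (rot i) (rot a) (rot-unit a))) (cong (_⊗ conj (rot a)) (sym (rot-+ i a)))

forward : ∀ j b → circlePoint (j ℕ.+ b) ⊖ circlePoint j ≡ circlePoint j ⊗ chord (rot b)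
forward j b = trans (cong (λ z → z ⊗ z ⊖ circlePoint j) (rot-+ j b))
  (square-⊖ (rot j) (rot b) (rot-unit b))

circlePoint-unit : ∀ m → dot (circlePoint m) (circlePoint m) ≡ 1ℚ
circlePoint-unit m = trans (dot-⊗ (rot m) (rot m) (rot m)) (cong₂ ℚ._*_ (rot-unit m) (rot-unit m))

dot-circlePoint-⊗ : ∀ m α β → dot (circlePoint m ⊗ α) (circlePoint m ⊗ β) ≡ dot α β
dot-circlePoint-⊗ m α β = trans (dot-⊗ (circlePoint m) α β)
  (trans (cong (ℚ._* dot α β) (circlePoint-unit m)) (ℚₚ.*-identityˡ (dot α β)))

cross-circlePoint-⊗ : ∀ m α β → cross (circlePoint m ⊗ α) (circlePoint m ⊗ β) ≡ cross α β
cross-circlePoint-⊗ m α β = trans (cross-⊗ (circlePoint m) α β)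
  (trans (cong (ℚ._* cross α β) (circlePoint-unit m)) (ℚₚ.*-identityˡ (cross α β)))

dot-chord : ∀ y → dot y y ≡ 1ℚ →
            dot (chord y) (chord y) ≡ (proj₂ y ℚ.+ proj₂ y) ℚ.* (proj₂ y ℚ.+ proj₂ y)
dot-chord (c , d) unit = trans (identity c d)
  (trans (cong ((d ℚ.+ d) ℚ.* (d ℚ.+ d) ℚ.*_) unit) (ℚₚ.*-identityʳ _))
  where
  identity : ∀ c d → (ℚ.- ((d ℚ.+ d) ℚ.* d)) ℚ.* (ℚ.- ((d ℚ.+ d) ℚ.* d)) ℚ.+ ((d ℚ.+ d) ℚ.* c) ℚ.* ((d ℚ.+ d) ℚ.* c) ≡
             ((d ℚ.+ d) ℚ.* (d ℚ.+ d)) ℚ.* (c ℚ.* c ℚ.+ d ℚ.* d)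
  identity = solve-∀ ℚ-ring

dot-chords : ∀ y v → dot (chord (conj y)) (chord v) ≡
  ((proj₂ y ℚ.+ proj₂ y) ℚ.* (proj₂ v ℚ.+ proj₂ v)) ℚ.* (ℚ.- proj₁ (y ⊗ v))
dot-chords (a , b) (c , d) = identity a b c d
  where
  identity : ∀ a b c d →
    (ℚ.- ((ℚ.- b ℚ.+ ℚ.- b) ℚ.* (ℚ.- b))) ℚ.* (ℚ.- ((d ℚ.+ d) ℚ.* d)) ℚ.+
    ((ℚ.- b ℚ.+ ℚ.- b) ℚ.* a) ℚ.* ((d ℚ.+ d) ℚ.* c) ≡
    ((b ℚ.+ b) ℚ.* (d ℚ.+ d)) ℚ.* (ℚ.- (a ℚ.* c ℚ.- b ℚ.* d))
  identity = solve-∀ ℚ-ring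

cross-chords : ∀ y v → cross (chord (conj y)) (chord v) ≡
  ((proj₂ y ℚ.+ proj₂ y) ℚ.* (proj₂ v ℚ.+ proj₂ v)) ℚ.* (ℚ.- proj₂ (y ⊗ v))
cross-chords (a , b) (c , d) = identity a b c d
  where
  identity : ∀ a b c d →
    (ℚ.- ((ℚ.- b ℚ.+ ℚ.- b) ℚ.* (ℚ.- b))) ℚ.* ((d ℚ.+ d) ℚ.* c) ℚ.-
    ((ℚ.- b ℚ.+ ℚ.- b) ℚ.* a) ℚ.* (ℚ.- ((d ℚ.+ d) ℚ.* d)) ≡
    ((b ℚ.+ b) ℚ.* (d ℚ.+ d)) ℚ.* (ℚ.- (a ℚ.* d ℚ.+ b ℚ.* c))
  identity = solve-∀ ℚ-ring

dot-backward : ∀ i a → let A = circlePoint i ⊖ circlePoint (i ℕ.+ a) in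
               dot A A ≡ sin₂ a ℚ.* sin₂ a
dot-backward i a = trans (cong₂ dot (backward i a) (backward i a))
  (trans (dot-circlePoint-⊗ (i ℕ.+ a) _ _)
    (trans (dot-chord (conj (rot a)) (conj-unit (rot a) (rot-unit a))) (neg² (sin a))))
  where
  neg² : ∀ d → (ℚ.- d ℚ.+ ℚ.- d) ℚ.* (ℚ.- d ℚ.+ ℚ.- d) ≡ (d ℚ.+ d) ℚ.* (d ℚ.+ d)
  neg² = solve-∀ ℚ-ring

dot-forward : ∀ j b → let B = circlePoint (j ℕ.+ b) ⊖ circlePoint j in
              dot B B ≡ sin₂ b ℚ.* sin₂ b
dot-forward j b = trans (cong₂ dot (forward j b) (forward j b))
  (trans (dot-circlePoint-⊗ j _ _) (dot-chord (rot b) (rot-unit b)))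

-- The legs have lengths |2 sin a| and |2 sin b|, so the cosine of the angle is ± cos (a + b): only
-- the arc from i to k and the signs of the two sines enter.
dot-circle : ∀ i a b → let j = i ℕ.+ a in
  dot (circlePoint i ⊖ circlePoint j) (circlePoint (j ℕ.+ b) ⊖ circlePoint j) ≡
  (sin₂ a ℚ.* sin₂ b) ℚ.* (ℚ.- cos (a ℕ.+ b))
dot-circle i a b = trans (cong₂ dot (backward i a) (forward (i ℕ.+ a) b))
  (trans (dot-circlePoint-⊗ (i ℕ.+ a) _ _)
    (trans (dot-chords (rot a) (rot b))
      (cong (λ z → (sin₂ a ℚ.* sin₂ b) ℚ.* (ℚ.- proj₁ z)) (sym (rot-+ a b)))))

cross-circle : ∀ i a b → let j = i ℕ.+ a in
  orient (circlePoint j) (circlePoint i) (circlePoint (j ℕ.+ b)) ≡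
  (sin₂ a ℚ.* sin₂ b) ℚ.* (ℚ.- sin (a ℕ.+ b))
cross-circle i a b = trans (cong₂ cross (backward i a) (forward (i ℕ.+ a) b))
  (trans (cross-circlePoint-⊗ (i ℕ.+ a) _ _)
    (trans (cross-chords (rot a) (rot b))
      (cong (λ z → (sin₂ a ℚ.* sin₂ b) ℚ.* (ℚ.- proj₂ z)) (sym (rot-+ a b)))))

-- Angle classes on the circle

signBit : ℚ → Fin 2
signBit x with 0ℚ ℚₚ.≤? x
... | yes _ = 0F
... | no  _ = 1F

neg-involutive : ∀ x → x ≡ ℚ.- (ℚ.- x)
neg-involutive = solve-∀ ℚ-ring

-- The ratio y / x is the factor by which `transfer-measure` rescales a leg; equal signs make it
-- positive.
sameSign⇒ratio : ∀ {x y} → x ≢ 0ℚ → y ≢ 0ℚ → signBit x ≡ signBit y →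
                 ∃[ s ] (0ℚ ℚ.≤ s × y ≡ s ℚ.* x)
sameSign⇒ratio {x} {y} x≢0 y≢0 same with 0ℚ ℚₚ.≤? x | 0ℚ ℚₚ.≤? y
... | yes 0≤x | yes 0≤y =
  let s , s>0 , xs≡y = quotient {x} {y} (≤∧≢0⇒< x≢0 0≤x) (≤∧≢0⇒< y≢0 0≤y)
  in s , ℚₚ.<⇒≤ s>0 , trans (sym xs≡y) (ℚₚ.*-comm x s)
  where
  ≤∧≢0⇒< : ∀ {z} → z ≢ 0ℚ → 0ℚ ℚ.≤ z → 0ℚ ℚ.< z
  ≤∧≢0⇒< z≢0 0≤z = ℚₚ.≰⇒> λ z≤0 → z≢0 (ℚₚ.≤-antisym z≤0 0≤z)
... | no 0≰x | no 0≰y =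
  let s , s>0 , eq = quotient {ℚ.- x} {ℚ.- y} (0<- 0≰x) (0<- 0≰y)
  in s , ℚₚ.<⇒≤ s>0 ,
     trans (neg-involutive y) (trans (cong ℚ.-_ (sym eq)) (double-neg x s))
  where
  0<- : ∀ {z} → ¬ (0ℚ ℚ.≤ z) → 0ℚ ℚ.< ℚ.- z
  0<- 0≰z = ℚₚ.neg-antimono-< (ℚₚ.≰⇒> 0≰z)
  double-neg : ∀ x s → ℚ.- ((ℚ.- x) ℚ.* s) ≡ s ℚ.* x
  double-neg = solve-∀ ℚ-ring

transfer-circle : ∀ i a b i′ a′ b′ → 0 ℕ.< a → 0 ℕ.< b → 0 ℕ.< a′ → 0 ℕ.< b′ →
  signBit (sin₂ a) ≡ signBit (sin₂ a′) → signBit (sin₂ b) ≡ signBit (sin₂ b′) →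
  a ℕ.+ b ≡ a′ ℕ.+ b′ → ∀ θ →
  ∠ ⟦ circlePoint i ⟧ , ⟦ circlePoint (i ℕ.+ a) ⟧ , ⟦ circlePoint (i ℕ.+ a ℕ.+ b) ⟧ is θ →
  ∠ ⟦ circlePoint i′ ⟧ , ⟦ circlePoint (i′ ℕ.+ a′) ⟧ , ⟦ circlePoint (i′ ℕ.+ a′ ℕ.+ b′) ⟧ is θ
transfer-circle i a b i′ a′ b′ a>0 b>0 a′>0 b′>0 sa sb arc =
  let s , s≥0 , pa = sameSign⇒ratio (sin₂≢0 a>0) (sin₂≢0 a′>0) sa
      t , t≥0 , pb = sameSign⇒ratio (sin₂≢0 b>0) (sin₂≢0 b′>0) sb
  in transfer-measure
       (circlePoint i) (circlePoint (i ℕ.+ a)) (circlePoint (i ℕ.+ a ℕ.+ b))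
       (circlePoint i′) (circlePoint (i′ ℕ.+ a′)) (circlePoint (i′ ℕ.+ a′ ℕ.+ b′))
       s t s≥0 t≥0
       (trans (dot-backward i′ a′) (trans (cong₂ ℚ._*_ pa pa)
         (trans (square s (sin₂ a)) (cong ((s ℚ.* s) ℚ.*_) (sym (dot-backward i a))))))
       (trans (dot-forward (i′ ℕ.+ a′) b′) (trans (cong₂ ℚ._*_ pb pb)
         (trans (square t (sin₂ b)) (cong ((t ℚ.* t) ℚ.*_) (sym (dot-forward (i ℕ.+ a) b))))))
       (trans (dot-circle i′ a′ b′)
         (trans (cong₂ (λ u m → u ℚ.* (ℚ.- cos m)) (cong₂ ℚ._*_ pa pb) (sym arc))
           (trans (mixed s t (sin₂ a) (sin₂ b) (ℚ.- cos (a ℕ.+ b)))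
             (cong ((s ℚ.* t) ℚ.*_) (sym (dot-circle i a b))))))
  where
  square : ∀ s x → (s ℚ.* x) ℚ.* (s ℚ.* x) ≡ (s ℚ.* s) ℚ.* (x ℚ.* x)
  square = solve-∀ ℚ-ring
  mixed : ∀ s t x y z → ((s ℚ.* x) ℚ.* (t ℚ.* y)) ℚ.* z ≡ (s ℚ.* t) ℚ.* ((x ℚ.* y) ℚ.* z)
  mixed = solve-∀ ℚ-ring

-- Matching on `gap` replaces j by i + a, so that the geometry is stated with sums and truncated
-- subtraction appears only in the class.
data Gap (i : ℕ) : ℕ → Set where
  gap : ∀ a → 0 ℕ.< a → Gap i (i ℕ.+ a)

<⇒gap : ∀ {i j} → i ℕ.< j → Gap i j
<⇒gap {i} {j} i<j = subst (Gap i) (ℕₚ.m+[n∸m]≡n (ℕₚ.<⇒≤ i<j)) (gap (j ℕ.∸ i) (ℕₚ.m<n⇒0<n∸m i<j))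

-- By the inscribed angle theorem the angle is determined by the arc k - i up to
-- supplement, and the two signs tell which of the two angles it is.
circleClass : ∀ {n} → Fin n → Fin n → Fin n → Fin (n ℕ.* 4)
circleClass {n} i j k = combine {n} {4}
  (fromℕ< {toℕ k ℕ.∸ toℕ i} (ℕₚ.≤-<-trans (ℕₚ.m∸n≤m (toℕ k) (toℕ i)) (toℕ<n k)))
  (combine (signBit (sin₂ (toℕ j ℕ.∸ toℕ i))) (signBit (sin₂ (toℕ k ℕ.∸ toℕ j))))

transfer-gaps : ∀ {i j k i′ j′ k′} → Gap i j → Gap j k → Gap i′ j′ → Gap j′ k′ →
  signBit (sin₂ (j ℕ.∸ i)) ≡ signBit (sin₂ (j′ ℕ.∸ i′)) →
  signBit (sin₂ (k ℕ.∸ j)) ≡ signBit (sin₂ (k′ ℕ.∸ j′)) →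
  k ℕ.∸ i ≡ k′ ℕ.∸ i′ → ∀ θ →
  ∠ ⟦ circlePoint i ⟧ , ⟦ circlePoint j ⟧ , ⟦ circlePoint k ⟧ is θ →
  ∠ ⟦ circlePoint i′ ⟧ , ⟦ circlePoint j′ ⟧ , ⟦ circlePoint k′ ⟧ is θ
transfer-gaps {i} {i′ = i′} (gap a a>0) (gap b b>0) (gap a′ a′>0) (gap b′ b′>0) sa sb arc =
  transfer-circle i a b i′ a′ b′ a>0 b>0 a′>0 b′>0
    (subst₂ (λ u v → signBit (sin₂ u) ≡ signBit (sin₂ v)) (ℕₚ.m+n∸m≡n i a) (ℕₚ.m+n∸m≡n i′ a′) sa)
    (subst₂ (λ u v → signBit (sin₂ u) ≡ signBit (sin₂ v))
      (ℕₚ.m+n∸m≡n (i ℕ.+ a) b) (ℕₚ.m+n∸m≡n (i′ ℕ.+ a′) b′) sb)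
    (subst₂ _≡_ (arc-length i a b) (arc-length i′ a′ b′) arc)
  where
  arc-length : ∀ i a b → (i ℕ.+ a ℕ.+ b) ℕ.∸ i ≡ a ℕ.+ b
  arc-length i a b = trans (cong (ℕ._∸ i) (ℕₚ.+-assoc i a b)) (ℕₚ.m+n∸m≡n i (a ℕ.+ b))

circleConfig : ∀ n → Fin n → ℚ²
circleConfig n i = circlePoint (toℕ i)

transfer-class : ∀ {n} (i j k i′ j′ k′ : Fin n) →
  i Fin.< j → j Fin.< k → i′ Fin.< j′ → j′ Fin.< k′ →
  circleClass i j k ≡ circleClass i′ j′ k′ → ∀ θ →
  ∠ ⟦ circleConfig n i ⟧ , ⟦ circleConfig n j ⟧ , ⟦ circleConfig n k ⟧ is θ →
  ∠ ⟦ circleConfig n i′ ⟧ , ⟦ circleConfig n j′ ⟧ , ⟦ circleConfig n k′ ⟧ is θ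
transfer-class {n} i j k i′ j′ k′ i<j j<k i′<j′ j′<k′ eq =
  let arc , signs = combine-injective {n} {4} _ _ _ _ eq
      sa , sb = combine-injective {2} {2} _ _ _ _ signs
  in transfer-gaps (<⇒gap i<j) (<⇒gap j<k) (<⇒gap i′<j′) (<⇒gap j′<k′) sa sb
       (Finₚ.fromℕ<-injective _ _ _ _ arc)

*-≢0 : ∀ {x y} → x ≢ 0ℚ → y ≢ 0ℚ → x ℚ.* y ≢ 0ℚ
*-≢0 x≢0 y≢0 xy≡0 = y≢0 (*-cancelˡ-≢0 x≢0 xy≡0)

-≢0 : ∀ {x} → x ≢ 0ℚ → ℚ.- x ≢ 0ℚ
-≢0 {x} x≢0 -x≡0 = x≢0 (trans (neg-involutive x) (cong ℚ.-_ -x≡0))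

orient-gaps : ∀ {i j k} → Gap i j → Gap j k →
  orient (circlePoint j) (circlePoint i) (circlePoint k) ≢ 0ℚ
orient-gaps {i} (gap a a>0) (gap b b>0) = subst (_≢ 0ℚ) (sym (cross-circle i a b))
  (*-≢0 (*-≢0 (sin₂≢0 a>0) (sin₂≢0 b>0)) (-≢0 (sin≢0′ (ℕₚ.<-≤-trans a>0 (ℕₚ.m≤m+n a b)))))
  where
  sin≢0′ : ∀ {m} → 0 ℕ.< m → sin m ≢ 0ℚ
  sin≢0′ {suc m} _ = sin≢0 m

circlePoint-≢ : ∀ {i j} → Gap i j → circlePoint i ≢ circlePoint j
circlePoint-≢ {i} (gap a a>0) eq = *-≢0 (sin₂≢0 a>0) (sin₂≢0 a>0)
  (trans (sym (dot-backward i a)) (trans (cong (λ z → dot (z ⊖ q) (z ⊖ q)) eq) (dot-self q)))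
  where
  q = circlePoint (i ℕ.+ a)
  dot-self : ∀ p → dot (p ⊖ p) (p ⊖ p) ≡ 0ℚ
  dot-self (x , y) = identity x y
    where
    identity : ∀ x y → (x ℚ.- x) ℚ.* (x ℚ.- x) ℚ.+ (y ℚ.- y) ℚ.* (y ℚ.- y) ≡ 0ℚ
    identity = solve-∀ ℚ-ring

orient-swap : ∀ p q r → orient p r q ≡ ℚ.- orient p q r
orient-swap (a , b) (c , d) (e , f) = identity a b c d e f
  where
  identity : ∀ a b c d e f → (e ℚ.- a) ℚ.* (d ℚ.- b) ℚ.- (f ℚ.- b) ℚ.* (c ℚ.- a) ≡
             ℚ.- ((c ℚ.- a) ℚ.* (f ℚ.- b) ℚ.- (d ℚ.- b) ℚ.* (e ℚ.- a))
  identity = solve-∀ ℚ-ring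

orient-rotate : ∀ p q r → orient q r p ≡ orient p q r
orient-rotate (a , b) (c , d) (e , f) = identity a b c d e f
  where
  identity : ∀ a b c d e f → (e ℚ.- c) ℚ.* (b ℚ.- d) ℚ.- (f ℚ.- d) ℚ.* (a ℚ.- c) ≡
             ((c ℚ.- a) ℚ.* (f ℚ.- b) ℚ.- (d ℚ.- b) ℚ.* (e ℚ.- a))
  identity = solve-∀ ℚ-ring

orient-swap-≢0 : ∀ p q r → orient p q r ≢ 0ℚ → orient p r q ≢ 0ℚ
orient-swap-≢0 p q r ≢0 = subst (_≢ 0ℚ) (sym (orient-swap p q r)) (-≢0 ≢0)

orient-rotate-≢0 : ∀ p q r → orient p q r ≢ 0ℚ → orient q r p ≢ 0ℚ
orient-rotate-≢0 p q r ≢0 = subst (_≢ 0ℚ) (sym (orient-rotate p q r)) ≢0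

-- The index type is free because the cube is indexed by `Vec Bool d` and the final configurations
-- by `Fin n`.
NoThree : ∀ {I : Set} → (I → ℚ²) → Set
NoThree p = ∀ i j k → i ≢ j → i ≢ k → j ≢ k → orient (p i) (p j) (p k) ≢ 0ℚ

NoFour : ∀ {I : Set} → (I → ℚ²) → Set
NoFour p = ∀ i j k l → i ≢ j → i ≢ k → i ≢ l → j ≢ k → j ≢ l → k ≢ l →
           incircle (p i) (p j) (p k) (p l) ≢ 0ℚ

-- `orient-gaps` covers increasing indices with the centre listed first; since `orient` is
-- alternating, its nonvanishing extends to every order of the indices.
noThree-circle : ∀ n → NoThree (circleConfig n)
noThree-circle n i j k i≢j i≢k j≢k = cases (Finₚ.<-cmp i j) (Finₚ.<-cmp j k) (Finₚ.<-cmp i k)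
  where
  p = circleConfig n
  sorted : ∀ {x y z} → x Fin.< y → y Fin.< z → orient (p x) (p y) (p z) ≢ 0ℚ
  sorted {x} {y} {z} x<y y<z =
    orient-rotate-≢0 (p z) (p x) (p y) (orient-rotate-≢0 (p y) (p z) (p x)
      (orient-swap-≢0 (p y) (p x) (p z) (orient-gaps (<⇒gap x<y) (<⇒gap y<z))))
  cases : Tri (i Fin.< j) (i ≡ j) (j Fin.< i) → Tri (j Fin.< k) (j ≡ k) (k Fin.< j) →
          Tri (i Fin.< k) (i ≡ k) (k Fin.< i) → orient (p i) (p j) (p k) ≢ 0ℚ
  cases (tri≈ _ i≡j _) _ _ = contradiction i≡j i≢j
  cases _ (tri≈ _ j≡k _) _ = contradiction j≡k j≢k
  cases _ _ (tri≈ _ i≡k _) = contradiction i≡k i≢k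
  cases (tri< i<j _ _) (tri< j<k _ _) _ = sorted i<j j<k
  cases (tri< i<j _ _) (tri> _ _ k<j) (tri< i<k _ _) =
    orient-swap-≢0 (p i) (p k) (p j) (sorted i<k k<j)
  cases (tri< i<j _ _) (tri> _ _ k<j) (tri> _ _ k<i) =
    orient-rotate-≢0 (p k) (p i) (p j) (sorted k<i i<j)
  cases (tri> _ _ j<i) (tri< j<k _ _) (tri< i<k _ _) =
    orient-rotate-≢0 (p k) (p i) (p j) (orient-rotate-≢0 (p j) (p k) (p i)
      (orient-swap-≢0 (p j) (p i) (p k) (sorted j<i i<k)))
  cases (tri> _ _ j<i) (tri< j<k _ _) (tri> _ _ k<i) =
    orient-rotate-≢0 (p k) (p i) (p j) (orient-rotate-≢0 (p j) (p k) (p i) (sorted j<k k<i))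
  cases (tri> _ _ j<i) (tri> _ _ k<j) _ =
    orient-rotate-≢0 (p k) (p i) (p j) (orient-swap-≢0 (p k) (p j) (p i) (sorted k<j j<i))

circleConfig-injective : ∀ n {i j} → circleConfig n i ≡ circleConfig n j → i ≡ j
circleConfig-injective n {i} {j} eq with Finₚ.<-cmp i j
... | tri< i<j _ _ = contradiction eq (circlePoint-≢ (<⇒gap i<j))
... | tri≈ _ i≡j _ = i≡j
... | tri> _ _ j<i = contradiction (sym eq) (circlePoint-≢ (<⇒gap j<i))

noThreeCollinear : ∀ {n} (p : Fin n → ℚ²) → NoThree p → NoThreeCollinear (⟦_⟧ ∘ p)
noThreeCollinear p noThree f f-inj = ¬collinear (p ∘ f) 0F 1F 2F
  (noThree (f 0F) (f 1F) (f 2F) (f≢ λ ()) (f≢ λ ()) (f≢ λ ()))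
  where
  f≢ : ∀ {i j} → i ≢ j → f i ≢ f j
  f≢ i≢j = i≢j ∘ f-inj

noFourConcyclic : ∀ {n} (p : Fin n → ℚ²) → NoFour p → NoFourConcyclic (⟦_⟧ ∘ p)
noFourConcyclic p noFour f f-inj = ¬concyclic (p ∘ f) 0F 1F 2F 3F
  (noFour (f 0F) (f 1F) (f 2F) (f 3F)
    (f≢ λ ()) (f≢ λ ()) (f≢ λ ()) (f≢ λ ()) (f≢ λ ()) (f≢ λ ()))
  where
  f≢ : ∀ {i j} → i ≢ j → f i ≢ f j
  f≢ i≢j = i≢j ∘ f-inj

admissible : ∀ (𝒞 : PointClass) {n} (p : Fin n → ℚ²) → 3 ℕ.≤ n →
             (∀ {i j} → p i ≡ p j → i ≡ j) → NoThree p → 𝒞 (⟦_⟧ ∘ p) → Admissible 𝒞 (⟦_⟧ ∘ p)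
admissible 𝒞 p (s≤s (s≤s (s≤s _))) p-inj noThree inClass = record
  { distinct     = λ eq → p-inj (⟦⟧-injective eq)
  ; notCollinear = ¬collinear p 0F 1F 2F (noThree 0F 1F 2F (λ ()) (λ ()) (λ ()))
  ; inClass      = inClass
  }

circle-small : ∀ n → 1 ℕ.≤ n → ∀ Q → NoRepeatedAngle (⟦_⟧ ∘ circleConfig n) Q →
               ∣ Q ∣ ≤ 10 · n ^ₑ one-third
circle-small n 1≤n Q noRep p q _ q<3p = root-bound {∣ Q ∣} {n} {n} p q
  (ℕₚ.≤-trans cubed (begin
    125 ℕ.* (n ℕ.* 4)   ≡⟨ cong (125 ℕ.*_) (ℕₚ.*-comm n 4) ⟩
    125 ℕ.* (4 ℕ.* n)   ≡⟨ sym (ℕₚ.*-assoc 125 4 n) ⟩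
    -- 125 · 4 = 500 is rounded up to the cube 1000 that `root-bound` expects.
    500 ℕ.* n           ≤⟨ ℕₚ.*-monoˡ-≤ n (ℕₚ.m≤m+n 500 500) ⟩
    1000 ℕ.* n          ∎))
  (ℕₚ.^-monoʳ-≤ n {{ℕ.>-nonZero 1≤n}} (ℕₚ.<⇒≤ q<3p))
  where
  open ℕₚ.≤-Reasoning
  cubed : ∣ Q ∣ ℕ.^ 3 ℕ.≤ 125 ℕ.* (n ℕ.* 4)
  cubed = few-classes⇒small (circleConfig n) circleClass
    (ℕₚ.≤-trans 1≤n (ℕₚ.m≤m*n n 4))
    (λ i j k i<j j<k → orient-gaps (<⇒gap i<j) (<⇒gap j<k))
    (λ i j k i′ j′ k′ i<j j<k i′<j′ j′<k′ eq θ → mk⇔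
      (transfer-class i j k i′ j′ k′ i<j j<k i′<j′ j′<k′ eq θ)
      (transfer-class i′ j′ k′ i j k i′<j′ j′<k′ i<j j<k (sym eq) θ))
    Q noRep

circle-isO : ∀ (𝒞 : PointClass) → (∀ n → 𝒞 (⟦_⟧ ∘ circleConfig n)) → MinR 𝒞 isO[n^ one-third ]
circle-isO 𝒞 inClass = witness⇒isO 𝒞 one-third 10 3 λ n 3≤n →
  ⟦_⟧ ∘ circleConfig n ,
  admissible 𝒞 (circleConfig n) 3≤n (circleConfig-injective n) (noThree-circle n) (inClass n) ,
  circle-small n (ℕₚ.≤-trans (s≤s z≤n) 3≤n)

R-isO : R isO[n^ one-third ]
R-isO = circle-isO Unrestricted (λ _ → tt)

R-no3l-isO : R-no3l isO[n^ one-third ]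
R-no3l-isO = circle-isO NoThreeCollinear (λ n → noThreeCollinear (circleConfig n) (noThree-circle n))

-- Generic projections of the cube

Large : (ℚ → Set) → Set
Large P = ∃[ T ] (∀ t → T ℚ.≤ t → P t)

large-map : ∀ {P Q : ℚ → Set} → (∀ t → P t → Q t) → Large P → Large Q
large-map f (T , p) = T , λ t T≤t → f t (p t T≤t)

large-× : ∀ {P Q : ℚ → Set} → Large P → Large Q → Large (λ t → P t × Q t)
large-× (S , p) (T , q) = S ℚ.⊔ T , λ t S⊔T≤t →
  p t (ℚₚ.≤-trans (ℚₚ.p≤p⊔q S T) S⊔T≤t) , q t (ℚₚ.≤-trans (ℚₚ.p≤q⊔p S T) S⊔T≤t)

-- A threshold must be given before the hypothesis `A` is available, so `A` is decided first; if it
-- fails, any threshold will do.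
large-dec : ∀ {A : Set} {P : ℚ → Set} → Dec A → (A → Large P) → Large (λ t → A → P t)
large-dec (yes a) p = large-map (λ _ Pt _ → Pt) (p a)
large-dec (no ¬a) _ = 0ℚ , λ _ _ a → contradiction a ¬a

large-all : ∀ d {P : Vec Bool d → ℚ → Set} → (∀ x → Large (P x)) → Large (λ t → ∀ x → P x t)
large-all zero    p = large-map (λ { _ P[] [] → P[] }) (p [])
large-all (suc d) p = large-map (λ { t (f , g) (false ∷ x) → f x ; t (f , g) (true ∷ x) → g x })
  (large-× (large-all d (λ x → p (false ∷ x))) (large-all d (λ x → p (true ∷ x))))

large-≢ : ∀ {d} {P : ℚ → Set} (x y : Vec Bool d) →
          (x ≢ y → Large P) → Large (λ t → x ≢ y → P t)
large-≢ x y = large-dec (¬? (Vecₚ.≡-dec Boolₚ._≟_ x y))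

-- Unlike mere nonvanishing, a positive lower bound on |g t| survives a Horner step g t · t + c, so
-- it can be carried from the leading coefficient to the whole polynomial.
Away : (ℚ → ℚ) → Set
Away g = ∃[ δ ] (0ℚ ℚ.< δ × Large λ t → δ ℚ.≤ ℚ.∣ g t ∣)

away-const : ∀ {c} → c ≢ 0ℚ → Away (λ _ → c)
away-const {c} c≢0 = ℚ.∣ c ∣ , 0<∣∣ c≢0 , 0ℚ , λ _ _ → ℚₚ.≤-refl

+-cancelˡ-≤ : ∀ c {x y} → c ℚ.+ x ℚ.≤ c ℚ.+ y → x ℚ.≤ y
+-cancelˡ-≤ c {x} {y} c+x≤c+y =
  subst₂ ℚ._≤_ (cancel c x) (cancel c y) (ℚₚ.+-monoʳ-≤ (ℚ.- c) c+x≤c+y)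
  where
  cancel : ∀ c x → ℚ.- c ℚ.+ (c ℚ.+ x) ≡ x
  cancel = solve-∀ ℚ-ring

away-horner : ∀ {g} c → Away g → Away (λ t → g t ℚ.* t ℚ.+ c)
away-horner {g} c (δ , δ>0 , T , away) =
  1ℚ , ℚₚ.positive⁻¹ 1ℚ , T ℚ.⊔ S , λ t T⊔S≤t →
    let T≤t = ℚₚ.≤-trans (ℚₚ.p≤p⊔q T S) T⊔S≤t
        S≤t = ℚₚ.≤-trans (ℚₚ.p≤q⊔p T S) T⊔S≤t
        0≤t = ℚₚ.≤-trans (ℚₚ.<⇒≤ S>0) S≤t
    in +-cancelˡ-≤ ℚ.∣ c ∣ (begin
      ℚ.∣ c ∣ ℚ.+ 1ℚ                         ≡⟨ sym δS ⟩
      δ ℚ.* S                                ≤⟨ ℚₚ.*-monoˡ-≤-nonNeg δ {{ℚ.nonNegative (ℚₚ.<⇒≤ δ>0)}} S≤t ⟩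
      δ ℚ.* t                                ≤⟨ ℚₚ.*-monoʳ-≤-nonNeg t {{ℚ.nonNegative 0≤t}} (away t T≤t) ⟩
      ℚ.∣ g t ∣ ℚ.* t                        ≡⟨ cong (ℚ.∣ g t ∣ ℚ.*_) (sym (ℚₚ.0≤p⇒∣p∣≡p 0≤t)) ⟩
      ℚ.∣ g t ∣ ℚ.* ℚ.∣ t ∣                  ≡⟨ sym (ℚₚ.∣p*q∣≡∣p∣*∣q∣ (g t) t) ⟩
      ℚ.∣ g t ℚ.* t ∣                        ≡⟨ cong ℚ.∣_∣ (split (g t ℚ.* t) c) ⟩
      ℚ.∣ ℚ.- c ℚ.+ (g t ℚ.* t ℚ.+ c) ∣      ≤⟨ ℚₚ.∣p+q∣≤∣p∣+∣q∣ (ℚ.- c) (g t ℚ.* t ℚ.+ c) ⟩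
      ℚ.∣ ℚ.- c ∣ ℚ.+ ℚ.∣ g t ℚ.* t ℚ.+ c ∣  ≡⟨ cong (ℚ._+ ℚ.∣ g t ℚ.* t ℚ.+ c ∣) (ℚₚ.∣-p∣≡∣p∣ c) ⟩
      ℚ.∣ c ∣ ℚ.+ ℚ.∣ g t ℚ.* t ℚ.+ c ∣      ∎)
  where
  open ℚₚ.≤-Reasoning
  -- S solves δ S = |c| + 1: from there on g t · t exceeds c in absolute value by at least 1.
  threshold = quotient {δ} {ℚ.∣ c ∣ ℚ.+ 1ℚ} δ>0 (ℚₚ.+-mono-≤-< (ℚₚ.0≤∣p∣ c) (ℚₚ.positive⁻¹ 1ℚ))
  S = proj₁ threshold
  S>0 = proj₁ (proj₂ threshold)
  δS = proj₂ (proj₂ threshold)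
  split : ∀ x c → x ≡ ℚ.- c ℚ.+ (x ℚ.+ c)
  split = solve-∀ ℚ-ring

away⇒≢0 : ∀ {g} → Away g → Large (λ t → g t ≢ 0ℚ)
away⇒≢0 (δ , δ>0 , away) = large-map (λ t δ≤ gt≡0 →
  ℚₚ.<-irrefl refl (ℚₚ.<-≤-trans δ>0 (subst (λ z → δ ℚ.≤ ℚ.∣ z ∣) gt≡0 δ≤))) away

linear≢0 : ∀ c₁ c₀ → ¬ (c₁ ≡ 0ℚ × c₀ ≡ 0ℚ) → Large (λ t → c₁ ℚ.* t ℚ.+ c₀ ≢ 0ℚ)
linear≢0 c₁ c₀ nz with c₁ ℚₚ.≟ 0ℚ
... | no c₁≢0 = away⇒≢0 (away-horner c₀ (away-const c₁≢0))
... | yes refl = 0ℚ , λ t _ eq → nz (refl , trans (drop t c₀) eq)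
  where
  drop : ∀ t c → c ≡ 0ℚ ℚ.* t ℚ.+ c
  drop = solve-∀ ℚ-ring

quadratic≢0 : ∀ c₂ c₁ c₀ → ¬ (c₂ ≡ 0ℚ × c₁ ≡ 0ℚ × c₀ ≡ 0ℚ) →
              Large (λ t → (c₂ ℚ.* t ℚ.+ c₁) ℚ.* t ℚ.+ c₀ ≢ 0ℚ)
quadratic≢0 c₂ c₁ c₀ nz with c₂ ℚₚ.≟ 0ℚ
... | no c₂≢0 = away⇒≢0 (away-horner c₀ (away-horner c₁ (away-const c₂≢0)))
... | yes refl = large-map (λ t ≢0 eq → ≢0 (trans (drop t c₁ c₀) eq))
      (linear≢0 c₁ c₀ (λ (c₁≡0 , c₀≡0) → nz (refl , c₁≡0 , c₀≡0)))
  where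
  drop : ∀ t c₁ c₀ → c₁ ℚ.* t ℚ.+ c₀ ≡ (0ℚ ℚ.* t ℚ.+ c₁) ℚ.* t ℚ.+ c₀
  drop = solve-∀ ℚ-ring

-- Determinants of points moving along a line

infixr 7 _•_
_•_ : ℚ → ℚ² → ℚ²
t • (a , b) = t ℚ.* a , t ℚ.* b

⊝_ : ℚ² → ℚ²
⊝ (a , b) = ℚ.- a , ℚ.- b

⊕-⊖-comm : ∀ r v p → (r ⊕ v) ⊖ p ≡ (r ⊖ p) ⊕ v
⊕-⊖-comm (a , b) (c , d) (e , f) = cong₂ _,_ (identity a c e) (identity b d f)
  where
  identity : ∀ a c e → (a ℚ.+ c) ℚ.- e ≡ (a ℚ.- e) ℚ.+ c
  identity = solve-∀ ℚ-ring

⊖-⊕-cancel : ∀ q v p → (q ⊕ v) ⊖ (p ⊕ v) ≡ q ⊖ p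
⊖-⊕-cancel (a , b) (c , d) (e , f) = cong₂ _,_ (identity a c e) (identity b d f)
  where
  identity : ∀ a c e → (a ℚ.+ c) ℚ.- (e ℚ.+ c) ≡ a ℚ.- e
  identity = solve-∀ ℚ-ring

⊖-⊕ : ∀ r t u p → r ⊖ (p ⊕ t • u) ≡ (r ⊖ p) ⊕ t • (⊝ u)
⊖-⊕ (a , b) t (c , d) (e , f) = cong₂ _,_ (identity a t c e) (identity b t d f)
  where
  identity : ∀ a t c e → a ℚ.- (e ℚ.+ t ℚ.* c) ≡ (a ℚ.- e) ℚ.+ t ℚ.* (ℚ.- c)
  identity = solve-∀ ℚ-ring

cross-line : ∀ a c t u → cross a (c ⊕ t • u) ≡ cross a u ℚ.* t ℚ.+ cross a c
cross-line (a , b) (c , d) t (e , f) = identity a b c d t e f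
  where
  identity : ∀ a b c d t e f → a ℚ.* (d ℚ.+ t ℚ.* f) ℚ.- b ℚ.* (c ℚ.+ t ℚ.* e) ≡
             (a ℚ.* f ℚ.- b ℚ.* e) ℚ.* t ℚ.+ (a ℚ.* d ℚ.- b ℚ.* c)
  identity = solve-∀ ℚ-ring

cross-line₂ : ∀ b c t u → cross (b ⊕ t • u) (c ⊕ t • u) ≡ (cross b u ℚ.+ cross u c) ℚ.* t ℚ.+ cross b c
cross-line₂ (a , b) (c , d) t (e , f) = identity a b c d t e f
  where
  identity : ∀ a b c d t e f →
    (a ℚ.+ t ℚ.* e) ℚ.* (d ℚ.+ t ℚ.* f) ℚ.- (b ℚ.+ t ℚ.* f) ℚ.* (c ℚ.+ t ℚ.* e) ≡
    ((a ℚ.* f ℚ.- b ℚ.* e) ℚ.+ (e ℚ.* d ℚ.- f ℚ.* c)) ℚ.* t ℚ.+ (a ℚ.* d ℚ.- b ℚ.* c)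
  identity = solve-∀ ℚ-ring

cross-anti : ∀ a b → cross a b ≡ ℚ.- cross b a
cross-anti (a , b) (c , d) = identity a b c d
  where
  identity : ∀ a b c d → a ℚ.* d ℚ.- b ℚ.* c ≡ ℚ.- (c ℚ.* b ℚ.- d ℚ.* a)
  identity = solve-∀ ℚ-ring

dot-line : ∀ c t u → dot (c ⊕ t • u) (c ⊕ t • u) ≡
           (dot u u ℚ.* t ℚ.+ (dot c u ℚ.+ dot c u)) ℚ.* t ℚ.+ dot c c
dot-line (c , d) t (e , f) = identity c d t e f
  where
  identity : ∀ c d t e f →
    (c ℚ.+ t ℚ.* e) ℚ.* (c ℚ.+ t ℚ.* e) ℚ.+ (d ℚ.+ t ℚ.* f) ℚ.* (d ℚ.+ t ℚ.* f) ≡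
    ((e ℚ.* e ℚ.+ f ℚ.* f) ℚ.* t ℚ.+ ((c ℚ.* e ℚ.+ d ℚ.* f) ℚ.+ (c ℚ.* e ℚ.+ d ℚ.* f))) ℚ.* t
      ℚ.+ (c ℚ.* c ℚ.+ d ℚ.* d)
  identity = solve-∀ ℚ-ring

det₃-line : ∀ a b c u → ∃[ c₁ ] ∃[ c₀ ] (∀ t → det₃ a b (c ⊕ t • u) ≡
            ((dot u u ℚ.* cross a b) ℚ.* t ℚ.+ c₁) ℚ.* t ℚ.+ c₀)
-- The lower coefficients are found by unification with `identity`; the leading one is what later
-- guarantees nonvanishing.
det₃-line a b c u = _ , _ , λ t →
  trans (cong₂ ℚ._+_ (cong₂ ℚ._+_
      (cong (dot a a ℚ.*_) (cross-line b c t u))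
      (cong (dot b b ℚ.*_) (trans (cross-anti (c ⊕ t • u) a) (cong ℚ.-_ (cross-line a c t u)))))
      (cong (ℚ._* cross a b) (dot-line c t u)))
    (identity (dot a a) (dot b b) (dot c c) (cross b u) (cross b c) (cross a u) (cross a c)
              (cross a b) (dot u u) (dot c u) t)
  where
  identity : ∀ A B C bu bc au ac ab U cu t →
    (A ℚ.* (bu ℚ.* t ℚ.+ bc) ℚ.+ B ℚ.* (ℚ.- (au ℚ.* t ℚ.+ ac))) ℚ.+
      ((U ℚ.* t ℚ.+ (cu ℚ.+ cu)) ℚ.* t ℚ.+ C) ℚ.* ab ≡
    ((U ℚ.* ab) ℚ.* t ℚ.+ (A ℚ.* bu ℚ.- B ℚ.* au ℚ.+ (cu ℚ.+ cu) ℚ.* ab)) ℚ.* t ℚ.+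
      (A ℚ.* bc ℚ.- B ℚ.* ac ℚ.+ C ℚ.* ab)
  identity = solve-∀ ℚ-ring

-- The t³-terms cancel, and at u = (1 , m) the coefficient of t² is, with
-- e = b - c, the quadratic -Im(ae) m² - 2 Re(ae) m + Im(ae).
leading : ℚ² → ℚ² → ℚ → ℚ
leading a e m =
  ((ℚ.- proj₂ (a ⊗ e)) ℚ.* m ℚ.+ (ℚ.- (proj₁ (a ⊗ e) ℚ.+ proj₁ (a ⊗ e)))) ℚ.* m ℚ.+ proj₂ (a ⊗ e)

leading-coefficient : ∀ a b c m → let u = 1ℚ , m in
  ((dot u u ℚ.* (cross a b ℚ.- cross a c)) ℚ.- (dot b u ℚ.+ dot b u) ℚ.* cross a u)
    ℚ.+ (dot c u ℚ.+ dot c u) ℚ.* cross a u ≡ leading a (b ⊖ c) m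
leading-coefficient (a , b) (c , d) (e , f) m = identity a b c d e f m
  where
  identity : ∀ a b c d e f m →
    (((1ℚ ℚ.* 1ℚ ℚ.+ m ℚ.* m) ℚ.* ((a ℚ.* d ℚ.- b ℚ.* c) ℚ.- (a ℚ.* f ℚ.- b ℚ.* e)))
      ℚ.- ((c ℚ.* 1ℚ ℚ.+ d ℚ.* m) ℚ.+ (c ℚ.* 1ℚ ℚ.+ d ℚ.* m)) ℚ.* (a ℚ.* m ℚ.- b ℚ.* 1ℚ))
      ℚ.+ ((e ℚ.* 1ℚ ℚ.+ f ℚ.* m) ℚ.+ (e ℚ.* 1ℚ ℚ.+ f ℚ.* m)) ℚ.* (a ℚ.* m ℚ.- b ℚ.* 1ℚ) ≡
    ((ℚ.- (a ℚ.* (d ℚ.- f) ℚ.+ b ℚ.* (c ℚ.- e))) ℚ.* m ℚ.+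
      (ℚ.- ((a ℚ.* (c ℚ.- e) ℚ.- b ℚ.* (d ℚ.- f)) ℚ.+ (a ℚ.* (c ℚ.- e) ℚ.- b ℚ.* (d ℚ.- f))))) ℚ.* m
      ℚ.+ (a ℚ.* (d ℚ.- f) ℚ.+ b ℚ.* (c ℚ.- e))
  identity = solve-∀ ℚ-ring

det₃-line₂ : ∀ a b c m → ∃[ c₁ ] ∃[ c₀ ] (∀ t → let u = 1ℚ , m in
  det₃ a (b ⊕ t • u) (c ⊕ t • u) ≡ (leading a (b ⊖ c) m ℚ.* t ℚ.+ c₁) ℚ.* t ℚ.+ c₀)
det₃-line₂ a b c m = c₁ , c₀ , λ t →
  trans (cong₂ ℚ._+_ (cong₂ ℚ._+_
      (cong (dot a a ℚ.*_) (cross-line₂ b c t u))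
      (cong₂ ℚ._*_ (dot-line b t u) (trans (cross-anti (c ⊕ t • u) a) (cong ℚ.-_ (cross-line a c t u)))))
      (cong₂ ℚ._*_ (dot-line c t u) (cross-line a b t u)))
    (trans (identity (dot a a) (dot b b) (dot c c) (cross b u ℚ.+ cross u c) (cross b c)
                     (cross a u) (cross a c) (cross a b) (dot u u) (dot b u) (dot c u) t)
      (cong (λ z → (z ℚ.* t ℚ.+ c₁) ℚ.* t ℚ.+ c₀) (leading-coefficient a b c m)))
  where
  u : ℚ²
  u = 1ℚ , m
  c₁ c₀ : ℚ
  c₁ = dot a a ℚ.* (cross b u ℚ.+ cross u c) ℚ.- (dot b u ℚ.+ dot b u) ℚ.* cross a c ℚ.-
       dot b b ℚ.* cross a u ℚ.+ (dot c u ℚ.+ dot c u) ℚ.* cross a b ℚ.+ dot c c ℚ.* cross a u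
  c₀ = dot a a ℚ.* cross b c ℚ.- dot b b ℚ.* cross a c ℚ.+ dot c c ℚ.* cross a b
  identity : ∀ A B C buc bc au ac ab U bu cu t →
    (A ℚ.* (buc ℚ.* t ℚ.+ bc) ℚ.+
     ((U ℚ.* t ℚ.+ (bu ℚ.+ bu)) ℚ.* t ℚ.+ B) ℚ.* (ℚ.- (au ℚ.* t ℚ.+ ac))) ℚ.+
     ((U ℚ.* t ℚ.+ (cu ℚ.+ cu)) ℚ.* t ℚ.+ C) ℚ.* (au ℚ.* t ℚ.+ ab) ≡
    ((((U ℚ.* (ab ℚ.- ac)) ℚ.- (bu ℚ.+ bu) ℚ.* au) ℚ.+ (cu ℚ.+ cu) ℚ.* au) ℚ.* t ℚ.+
      (A ℚ.* buc ℚ.- (bu ℚ.+ bu) ℚ.* ac ℚ.- B ℚ.* au ℚ.+ (cu ℚ.+ cu) ℚ.* ab ℚ.+ C ℚ.* au)) ℚ.* t ℚ.+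
      (A ℚ.* bc ℚ.- B ℚ.* ac ℚ.+ C ℚ.* ab)
  identity = solve-∀ ℚ-ring

0≤x² : ∀ x → 0ℚ ℚ.≤ x ℚ.* x
0≤x² x = begin
  0ℚ                      ≡⟨ sym (ℚₚ.*-zeroʳ ℚ.∣ x ∣) ⟩
  ℚ.∣ x ∣ ℚ.* 0ℚ          ≤⟨ ℚₚ.*-monoˡ-≤-nonNeg ℚ.∣ x ∣ {{ℚ.nonNegative (ℚₚ.0≤∣p∣ x)}} (ℚₚ.0≤∣p∣ x) ⟩
  ℚ.∣ x ∣ ℚ.* ℚ.∣ x ∣     ≡⟨ unsign (ℚₚ.∣p∣≡p∨∣p∣≡-p x) ⟩
  x ℚ.* x                 ∎
  where
  open ℚₚ.≤-Reasoning
  neg² : ∀ x → (ℚ.- x) ℚ.* (ℚ.- x) ≡ x ℚ.* x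
  neg² = solve-∀ ℚ-ring
  unsign : ℚ.∣ x ∣ ≡ x ⊎ ℚ.∣ x ∣ ≡ ℚ.- x → ℚ.∣ x ∣ ℚ.* ℚ.∣ x ∣ ≡ x ℚ.* x
  unsign (inj₁ eq) = cong₂ ℚ._*_ eq eq
  unsign (inj₂ eq) = trans (cong₂ ℚ._*_ eq eq) (neg² x)

x²+y²≡0⇒x≡0 : ∀ x y → x ℚ.* x ℚ.+ y ℚ.* y ≡ 0ℚ → x ≡ 0ℚ
x²+y²≡0⇒x≡0 x y sum≡0 = square≡0 (ℚₚ.≤-antisym
  (subst₂ ℚ._≤_ (ℚₚ.+-identityʳ (x ℚ.* x)) sum≡0 (ℚₚ.+-monoʳ-≤ (x ℚ.* x) (0≤x² y)))
  (0≤x² x))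

dot-self≢0 : ∀ {a} → a ≢ (0ℚ , 0ℚ) → dot a a ≢ 0ℚ
dot-self≢0 {x , y} a≢0 dot≡0 = a≢0 (cong₂ _,_ (x²+y²≡0⇒x≡0 x y dot≡0)
  (x²+y²≡0⇒x≡0 y x (trans (ℚₚ.+-comm (y ℚ.* y) (x ℚ.* x)) dot≡0)))

-x≡0⇒x≡0 : ∀ {x} → ℚ.- x ≡ 0ℚ → x ≡ 0ℚ
-x≡0⇒x≡0 {x} -x≡0 with x ℚₚ.≟ 0ℚ
... | yes x≡0 = x≡0
... | no  x≢0 = contradiction -x≡0 (-≢0 x≢0)

x+x≡0⇒x≡0 : ∀ {x} → x ℚ.+ x ≡ 0ℚ → x ≡ 0ℚ
x+x≡0⇒x≡0 {x} eq = *-cancelˡ-≢0 {1ℚ ℚ.+ 1ℚ} {x} (λ ()) (trans (double x) eq)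
  where
  double : ∀ x → (1ℚ ℚ.+ 1ℚ) ℚ.* x ≡ x ℚ.+ x
  double = solve-∀ ℚ-ring

-- All three coefficients vanish only if the complex product ae is 0, which |ae|² = |a|²|e|²
-- excludes.
leading≢0 : ∀ a e → a ≢ (0ℚ , 0ℚ) → e ≢ (0ℚ , 0ℚ) → Large (λ m → leading a e m ≢ 0ℚ)
leading≢0 a e a≢0 e≢0 = quadratic≢0 (ℚ.- im) (ℚ.- (re ℚ.+ re)) im λ (_ , c₁≡0 , im≡0) →
  *-≢0 (dot-self≢0 a≢0) (dot-self≢0 e≢0) (trans (sym (dot-⊗ a e e))
    (cong₂ (λ x y → x ℚ.* x ℚ.+ y ℚ.* y) (x+x≡0⇒x≡0 {re} (-x≡0⇒x≡0 {re ℚ.+ re} c₁≡0)) im≡0))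
  where
  re = proj₁ (a ⊗ e)
  im = proj₂ (a ⊗ e)

⊖≡0⇒≡ : ∀ {p q} → p ⊖ q ≡ (0ℚ , 0ℚ) → p ≡ q
⊖≡0⇒≡ {a , b} {c , d} eq = cong₂ _,_ (x∙y⁻¹≈ε⇒x≈y a c (cong proj₁ eq)) (x∙y⁻¹≈ε⇒x≈y b d (cong proj₂ eq))

cross-direction≢0 : ∀ a → a ≢ (0ℚ , 0ℚ) → Large (λ m → cross a (1ℚ , m) ≢ 0ℚ)
cross-direction≢0 (x , y) a≢0 = large-map (λ m → subst (_≢ 0ℚ) (sym (identity x y m)))
  (linear≢0 x (ℚ.- y) λ (x≡0 , -y≡0) → a≢0 (cong₂ _,_ x≡0 (-x≡0⇒x≡0 -y≡0)))
  where
  identity : ∀ x y m → x ℚ.* m ℚ.- y ℚ.* 1ℚ ≡ x ℚ.* m ℚ.+ ℚ.- y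
  identity = solve-∀ ℚ-ring

cross-⊝ : ∀ a u → cross a (⊝ u) ≡ ℚ.- cross a u
cross-⊝ (a , b) (c , d) = identity a b c d
  where
  identity : ∀ a b c d → a ℚ.* (ℚ.- d) ℚ.- b ℚ.* (ℚ.- c) ≡ ℚ.- (a ℚ.* d ℚ.- b ℚ.* c)
  identity = solve-∀ ℚ-ring

large-cross : ∀ a c w → cross a w ≢ 0ℚ → Large (λ t → cross a (c ⊕ t • w) ≢ 0ℚ)
large-cross a c w aw≢0 = large-map
  (λ t → subst (_≢ 0ℚ) (sym (cross-line a c t w)))
  (linear≢0 (cross a w) (cross a c) (aw≢0 ∘ proj₁))

-- With one moving point the t²-coefficient is |w|² times `cross a b`. It is nonzero in every
-- direction, as the moving point finally leaves the circle through the origin, a and b.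
large-det₃ : ∀ a b c w → w ≢ (0ℚ , 0ℚ) → cross a b ≢ 0ℚ → Large (λ t → det₃ a b (c ⊕ t • w) ≢ 0ℚ)
large-det₃ a b c w w≢0 ab≢0 =
  let c₁ , c₀ , eq = det₃-line a b c w
  in large-map (λ t → subst (_≢ 0ℚ) (sym (eq t)))
       (quadratic≢0 (dot w w ℚ.* cross a b) c₁ c₀ (*-≢0 (dot-self≢0 w≢0) ab≢0 ∘ proj₁))

-- A vector separating a configuration from its translate

Injects : ∀ {I : Set} → (I → ℚ²) → Set
Injects p = ∀ i j → i ≢ j → p i ≢ p j

module _ {d : ℕ} (f : Vec Bool d → ℚ²) where

  -- These are the leading coefficients in t that depend on the slope: `cross≢0` serves three points
  -- split between the copies, `lead≢0` four points split two and two. For a split of three and one,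
  -- `NoThree` supplies the leading coefficient.
  record SeparatingDirection (m : ℚ) : Set where
    field
      cross≢0  : ∀ x y → x ≢ y → cross (f y ⊖ f x) (1ℚ , m) ≢ 0ℚ
      lead≢0   : ∀ x y z w → x ≢ y → z ≢ w → leading (f y ⊖ f x) (f z ⊖ f w) m ≢ 0ℚ

  -- The field names count the points in the old copy and, after the bar, those in the translate.
  -- Points of different copies may come from the same index, so distinctness is assumed only within
  -- a copy.
  record Separating (v : ℚ²) : Set where
    field
      apart : ∀ x y → f x ≢ f y ⊕ v
      two∣1 : ∀ x y z → x ≢ y → orient (f x) (f y) (f z ⊕ v) ≢ 0ℚ
      one∣2 : ∀ x y z → x ≢ y → orient (f x ⊕ v) (f y ⊕ v) (f z) ≢ 0ℚ
      three∣1 : ∀ x y z w → x ≢ y → x ≢ z → y ≢ z → incircle (f x) (f y) (f z) (f w ⊕ v) ≢ 0ℚ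
      one∣3 : ∀ x y z w → x ≢ y → x ≢ z → y ≢ z → incircle (f x ⊕ v) (f y ⊕ v) (f z ⊕ v) (f w) ≢ 0ℚ
      two∣2 : ∀ x y z w → x ≢ y → z ≢ w → incircle (f x) (f y) (f z ⊕ v) (f w ⊕ v) ≢ 0ℚ

  difference≢0 : Injects f → ∀ x y → x ≢ y → f y ⊖ f x ≢ (0ℚ , 0ℚ)
  difference≢0 inj x y x≢y eq = inj x y x≢y (sym (⊖≡0⇒≡ {f y} {f x} eq))

  large-direction : Injects f → Large SeparatingDirection
  large-direction inj = large-map
    (λ m (c , l) → record { cross≢0 = c ; lead≢0 = l })
    (large-×
      (large-all d λ x → large-all d λ y → large-≢ x y λ x≢y →
        cross-direction≢0 (f y ⊖ f x) (difference≢0 inj x y x≢y))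
      (large-all d λ x → large-all d λ y → large-all d λ z → large-all d λ w →
        large-≢ x y λ x≢y → large-≢ z w λ z≢w →
        leading≢0 (f y ⊖ f x) (f z ⊖ f w) (difference≢0 inj x y x≢y)
                  (difference≢0 inj w z (≢-sym z≢w))))

  module _ {m : ℚ} (dir : SeparatingDirection m) (noThree : NoThree f) where
    open SeparatingDirection dir

    private
      u : ℚ²
      u = 1ℚ , m

    large-apart : ∀ x y → Large (λ t → f x ≢ f y ⊕ t • u)
    large-apart x y = large-map
      (λ t ≢0 eq → ≢0 (trans (identity (proj₁ (f y)) (proj₁ (f x)) t)
        (trans (cong (λ z → proj₁ (f y) ℚ.+ t ℚ.* 1ℚ ℚ.- z) (cong proj₁ eq))
               (ℚₚ.+-inverseʳ (proj₁ (f y) ℚ.+ t ℚ.* 1ℚ)))))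
      -- First coordinates suffice: that of `u` is 1, so their difference has slope 1 in t.
      (linear≢0 1ℚ (proj₁ (f y) ℚ.- proj₁ (f x)) (λ ()))
      where
      identity : ∀ y x t → 1ℚ ℚ.* t ℚ.+ (y ℚ.- x) ≡ y ℚ.+ t ℚ.* 1ℚ ℚ.- x
      identity = solve-∀ ℚ-ring

    large-two∣1 : ∀ x y z → x ≢ y → Large (λ t → orient (f x) (f y) (f z ⊕ t • u) ≢ 0ℚ)
    large-two∣1 x y z x≢y = large-map
      (λ t → subst (λ c → cross (f y ⊖ f x) c ≢ 0ℚ) (sym (⊕-⊖-comm (f z) (t • u) (f x))))
      (large-cross (f y ⊖ f x) (f z ⊖ f x) u (cross≢0 x y x≢y))

    -- Moving two points by t u amounts to moving the third by -t u, hence the direction `⊝ u`.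
    large-one∣2 : ∀ x y z → x ≢ y → Large (λ t → orient (f x ⊕ t • u) (f y ⊕ t • u) (f z) ≢ 0ℚ)
    large-one∣2 x y z x≢y = large-map
      (λ t → subst₂ (λ a c → cross a c ≢ 0ℚ) (sym (⊖-⊕-cancel (f y) (t • u) (f x)))
                    (sym (⊖-⊕ (f z) t u (f x))))
      (large-cross (f y ⊖ f x) (f z ⊖ f x) (⊝ u)
        (subst (_≢ 0ℚ) (sym (cross-⊝ (f y ⊖ f x) u)) (-≢0 (cross≢0 x y x≢y))))

    large-three∣1 : ∀ x y z w → x ≢ y → x ≢ z → y ≢ z →
      Large (λ t → incircle (f x) (f y) (f z) (f w ⊕ t • u) ≢ 0ℚ)
    large-three∣1 x y z w x≢y x≢z y≢z = large-map
      (λ t → subst (λ c → det₃ (f y ⊖ f x) (f z ⊖ f x) c ≢ 0ℚ) (sym (⊕-⊖-comm (f w) (t • u) (f x))))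
      (large-det₃ (f y ⊖ f x) (f z ⊖ f x) (f w ⊖ f x) u (λ ()) (noThree x y z x≢y x≢z y≢z))

    large-one∣3 : ∀ x y z w → x ≢ y → x ≢ z → y ≢ z →
      Large (λ t → incircle (f x ⊕ t • u) (f y ⊕ t • u) (f z ⊕ t • u) (f w) ≢ 0ℚ)
    large-one∣3 x y z w x≢y x≢z y≢z = large-map
      (λ t ≢0 → subst₂ (λ a b → det₃ a b (f w ⊖ (f x ⊕ t • u)) ≢ 0ℚ)
        (sym (⊖-⊕-cancel (f y) (t • u) (f x))) (sym (⊖-⊕-cancel (f z) (t • u) (f x)))
        (subst (λ c → det₃ (f y ⊖ f x) (f z ⊖ f x) c ≢ 0ℚ) (sym (⊖-⊕ (f w) t u (f x))) ≢0))
      (large-det₃ (f y ⊖ f x) (f z ⊖ f x) (f w ⊖ f x) (⊝ u) (λ ()) (noThree x y z x≢y x≢z y≢z))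

    large-two∣2 : ∀ x y z w → x ≢ y → z ≢ w →
      Large (λ t → incircle (f x) (f y) (f z ⊕ t • u) (f w ⊕ t • u) ≢ 0ℚ)
    large-two∣2 x y z w x≢y z≢w =
      let c₁ , c₀ , eq = det₃-line₂ (f y ⊖ f x) (f z ⊖ f x) (f w ⊖ f x) m
      in large-map
           (λ t ≢0 → subst₂ (λ b c → det₃ (f y ⊖ f x) b c ≢ 0ℚ)
             (sym (⊕-⊖-comm (f z) (t • u) (f x))) (sym (⊕-⊖-comm (f w) (t • u) (f x)))
             (subst (_≢ 0ℚ) (sym (eq t)) ≢0))
           (quadratic≢0 (leading (f y ⊖ f x) ((f z ⊖ f x) ⊖ (f w ⊖ f x)) m) c₁ c₀
             λ (lead≡0 , _) → lead≢0 x y z w x≢y z≢w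
               (trans (cong (λ e → leading (f y ⊖ f x) e m) (sym (common (f z) (f w) (f x)))) lead≡0))
      where
      common : ∀ p q r → (p ⊖ r) ⊖ (q ⊖ r) ≡ p ⊖ q
      common (a , b) (c , e) (g , h) = cong₂ _,_ (identity a c g) (identity b e h)
        where
        identity : ∀ a c g → (a ℚ.- g) ℚ.- (c ℚ.- g) ≡ a ℚ.- c
        identity = solve-∀ ℚ-ring

    large-separating : Large (λ t → Separating (t • u))
    large-separating = large-map
      (λ t (a , b , c , e , g , h) → record
        { apart = a ; two∣1 = b ; one∣2 = c ; three∣1 = e ; one∣3 = g ; two∣2 = h })
      (large-× (large-all d λ x → large-all d λ y → large-apart x y)
      (large-× (large-all d λ x → large-all d λ y → large-all d λ z →
                large-≢ x y (large-two∣1 x y z))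
      (large-× (large-all d λ x → large-all d λ y → large-all d λ z →
                large-≢ x y (large-one∣2 x y z))
      (large-× (large-all d λ x → large-all d λ y → large-all d λ z → large-all d λ w →
                large-≢ x y λ x≢y → large-≢ x z λ x≢z → large-≢ y z (large-three∣1 x y z w x≢y x≢z))
      (large-× (large-all d λ x → large-all d λ y → large-all d λ z → large-all d λ w →
                large-≢ x y λ x≢y → large-≢ x z λ x≢z → large-≢ y z (large-one∣3 x y z w x≢y x≢z))
               (large-all d λ x → large-all d λ y → large-all d λ z → large-all d λ w →
                large-≢ x y λ x≢y → large-≢ z w (large-two∣2 x y z w x≢y)))))))

  separating : Injects f → NoThree f → ∃[ v ] Separating v
  separating inj noThree =
    let m , direction = large-direction inj
        t , separates = large-separating (direction m ℚₚ.≤-refl) noThree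
    in t • (1ℚ , m) , separates t ℚₚ.≤-refl

-- Symmetries of the determinants and the step from d to d + 1

det₃-swapʳ : ∀ a b c → det₃ a c b ≡ ℚ.- det₃ a b c
det₃-swapʳ a b c = trans
  (cong₂ ℚ._+_ (cong₂ ℚ._+_ (cong (dot a a ℚ.*_) (cross-anti c b)) (cong (dot c c ℚ.*_) (cross-anti b a)))
         (cong (dot b b ℚ.*_) (cross-anti a c)))
  (identity (dot a a) (dot b b) (dot c c) (cross b c) (cross c a) (cross a b))
  where
  identity : ∀ A B C bc ca ab →
    (A ℚ.* (ℚ.- bc) ℚ.+ C ℚ.* (ℚ.- ab)) ℚ.+ B ℚ.* (ℚ.- ca) ≡ ℚ.- ((A ℚ.* bc ℚ.+ B ℚ.* ca) ℚ.+ C ℚ.* ab)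
  identity = solve-∀ ℚ-ring

det₃-swapˡ : ∀ a b c → det₃ b a c ≡ ℚ.- det₃ a b c
det₃-swapˡ a b c = trans
  (cong₂ ℚ._+_ (cong₂ ℚ._+_ (cong (dot b b ℚ.*_) (cross-anti a c)) (cong (dot a a ℚ.*_) (cross-anti c b)))
         (cong (dot c c ℚ.*_) (cross-anti b a)))
  (identity (dot a a) (dot b b) (dot c c) (cross b c) (cross c a) (cross a b))
  where
  identity : ∀ A B C bc ca ab →
    (B ℚ.* (ℚ.- ca) ℚ.+ A ℚ.* (ℚ.- bc)) ℚ.+ C ℚ.* (ℚ.- ab) ≡ ℚ.- ((A ℚ.* bc ℚ.+ B ℚ.* ca) ℚ.+ C ℚ.* ab)
  identity = solve-∀ ℚ-ring

-- `incircle` takes its first point as origin; making the second point the origin only changes the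
-- sign. Together with the two swaps of arguments of `det₃` this gives the three adjacent
-- transpositions, which generate all orders of four points.
det₃-rebase : ∀ a b c → det₃ (⊝ a) (b ⊖ a) (c ⊖ a) ≡ ℚ.- det₃ a b c
det₃-rebase (a , b) (c , d) (e , f) = identity a b c d e f
  where
  identity : ∀ a b c d e f →
    (((ℚ.- a) ℚ.* (ℚ.- a) ℚ.+ (ℚ.- b) ℚ.* (ℚ.- b)) ℚ.* ((c ℚ.- a) ℚ.* (f ℚ.- b) ℚ.- (d ℚ.- b) ℚ.* (e ℚ.- a)) ℚ.+
     ((c ℚ.- a) ℚ.* (c ℚ.- a) ℚ.+ (d ℚ.- b) ℚ.* (d ℚ.- b)) ℚ.* ((e ℚ.- a) ℚ.* (ℚ.- b) ℚ.- (f ℚ.- b) ℚ.* (ℚ.- a))) ℚ.+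
     ((e ℚ.- a) ℚ.* (e ℚ.- a) ℚ.+ (f ℚ.- b) ℚ.* (f ℚ.- b)) ℚ.* ((ℚ.- a) ℚ.* (d ℚ.- b) ℚ.- (ℚ.- b) ℚ.* (c ℚ.- a)) ≡
    ℚ.- (((a ℚ.* a ℚ.+ b ℚ.* b) ℚ.* (c ℚ.* f ℚ.- d ℚ.* e) ℚ.+
          (c ℚ.* c ℚ.+ d ℚ.* d) ℚ.* (e ℚ.* b ℚ.- f ℚ.* a)) ℚ.+
          (e ℚ.* e ℚ.+ f ℚ.* f) ℚ.* (a ℚ.* d ℚ.- b ℚ.* c))
  identity = solve-∀ ℚ-ring

⊖-swap : ∀ p q → p ⊖ q ≡ ⊝ (q ⊖ p)
⊖-swap (a , b) (c , d) = cong₂ _,_ (identity a c) (identity b d)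
  where
  identity : ∀ a c → a ℚ.- c ≡ ℚ.- (c ℚ.- a)
  identity = solve-∀ ℚ-ring

⊖-rebase : ∀ r p q → r ⊖ q ≡ (r ⊖ p) ⊖ (q ⊖ p)
⊖-rebase (a , b) (c , d) (e , f) = cong₂ _,_ (identity a c e) (identity b d f)
  where
  identity : ∀ a c e → a ℚ.- e ≡ (a ℚ.- c) ℚ.- (e ℚ.- c)
  identity = solve-∀ ℚ-ring

swap₁₂ : ∀ p q r s → incircle p q r s ≢ 0ℚ → incircle q p r s ≢ 0ℚ
swap₁₂ p q r s ≢0 eq = -≢0 ≢0 (trans (sym (det₃-rebase (q ⊖ p) (r ⊖ p) (s ⊖ p))) (trans
  (sym (trans (cong (λ a → det₃ a (r ⊖ q) (s ⊖ q)) (⊖-swap p q))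
              (cong₂ (det₃ (⊝ (q ⊖ p))) (⊖-rebase r p q) (⊖-rebase s p q)))) eq))

swap₂₃ : ∀ p q r s → incircle p q r s ≢ 0ℚ → incircle p r q s ≢ 0ℚ
swap₂₃ p q r s ≢0 eq = -≢0 ≢0 (trans (sym (det₃-swapˡ (q ⊖ p) (r ⊖ p) (s ⊖ p))) eq)

swap₃₄ : ∀ p q r s → incircle p q r s ≢ 0ℚ → incircle p q s r ≢ 0ℚ
swap₃₄ p q r s ≢0 eq = -≢0 ≢0 (trans (sym (det₃-swapʳ (q ⊖ p) (r ⊖ p) (s ⊖ p))) eq)

orient-⊕ : ∀ p q r v → orient (p ⊕ v) (q ⊕ v) (r ⊕ v) ≡ orient p q r
orient-⊕ p q r v = cong₂ cross (⊖-⊕-cancel q v p) (⊖-⊕-cancel r v p)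

incircle-⊕ : ∀ p q r s v → incircle (p ⊕ v) (q ⊕ v) (r ⊕ v) (s ⊕ v) ≡ incircle p q r s
incircle-⊕ p q r s v = trans
  (cong (λ a → det₃ a ((r ⊕ v) ⊖ (p ⊕ v)) ((s ⊕ v) ⊖ (p ⊕ v))) (⊖-⊕-cancel q v p))
  (cong₂ (det₃ (q ⊖ p)) (⊖-⊕-cancel r v p) (⊖-⊕-cancel s v p))

-- The linear map taking the standard basis to vs, restricted to {0,1}ᵈ.
cubePoint : ∀ {d} → Vec ℚ² d → Vec Bool d → ℚ²
cubePoint []       []          = 0ℚ , 0ℚ
cubePoint (v ∷ vs) (false ∷ x) = cubePoint vs x
cubePoint (v ∷ vs) (true  ∷ x) = cubePoint vs x ⊕ v

record GeneralProjection {d : ℕ} (vs : Vec ℚ² d) : Set where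
  field
    injects : Injects (cubePoint vs)
    noThree : NoThree (cubePoint vs)
    noFour  : NoFour (cubePoint vs)

-- Distinct vertices with different leading bits may share their tail. Distinctness therefore passes
-- to tails only within a copy, which is just what the fields of `Separating` assume.
tail≢ : ∀ {d b} {x y : Vec Bool d} → b ∷ x ≢ b ∷ y → x ≢ y
tail≢ ≢ refl = ≢ refl

⊕-cancel : ∀ p q v → p ⊕ v ≡ q ⊕ v → p ≡ q
⊕-cancel p q v eq = ⊖≡0⇒≡ {p} {q} (trans (sym (⊖-⊕-cancel p v q))
  (trans (cong (_⊖ (q ⊕ v)) eq) (⊖-self (q ⊕ v))))
  where
  ⊖-self : ∀ p → p ⊖ p ≡ (0ℚ , 0ℚ)
  ⊖-self (a , b) = cong₂ _,_ (ℚₚ.+-inverseʳ a) (ℚₚ.+-inverseʳ b)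

module _ {d : ℕ} {vs : Vec ℚ² d} (general : GeneralProjection vs)
         {v : ℚ²} (separating : Separating (cubePoint vs) v) where
  open GeneralProjection general
  open Separating separating

  private
    f f′ : Vec Bool d → ℚ²
    f = cubePoint vs
    f′ x = f x ⊕ v

  extend-injects : Injects (cubePoint (v ∷ vs))
  extend-injects (false ∷ x) (false ∷ y) ≢ eq = injects x y (tail≢ ≢) eq
  extend-injects (false ∷ x) (true  ∷ y) _ eq = apart x y eq
  extend-injects (true  ∷ x) (false ∷ y) _ eq = apart y x (sym eq)
  extend-injects (true  ∷ x) (true  ∷ y) ≢ eq = injects x y (tail≢ ≢) (⊕-cancel (f x) (f y) v eq)

  extend-noThree : NoThree (cubePoint (v ∷ vs))
  extend-noThree (false ∷ x) (false ∷ y) (false ∷ z) xy xz yz =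
    noThree x y z (tail≢ xy) (tail≢ xz) (tail≢ yz)
  extend-noThree (false ∷ x) (false ∷ y) (true ∷ z) xy _ _ = two∣1 x y z (tail≢ xy)
  extend-noThree (false ∷ x) (true ∷ y) (false ∷ z) _ xz _ =
    orient-swap-≢0 (f x) (f z) (f′ y) (two∣1 x z y (tail≢ xz))
  extend-noThree (true ∷ x) (false ∷ y) (false ∷ z) _ _ yz =
    orient-rotate-≢0 (f z) (f′ x) (f y) (orient-rotate-≢0 (f y) (f z) (f′ x) (two∣1 y z x (tail≢ yz)))
  extend-noThree (true ∷ x) (true ∷ y) (false ∷ z) xy _ _ = one∣2 x y z (tail≢ xy)
  extend-noThree (true ∷ x) (false ∷ y) (true ∷ z) _ xz _ =
    orient-swap-≢0 (f′ x) (f′ z) (f y) (one∣2 x z y (tail≢ xz))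
  extend-noThree (false ∷ x) (true ∷ y) (true ∷ z) _ _ yz =
    orient-rotate-≢0 (f′ z) (f x) (f′ y) (orient-rotate-≢0 (f′ y) (f′ z) (f x) (one∣2 y z x (tail≢ yz)))
  extend-noThree (true ∷ x) (true ∷ y) (true ∷ z) xy xz yz =
    subst (_≢ 0ℚ) (sym (orient-⊕ (f x) (f y) (f z) v))
      (noThree x y z (tail≢ xy) (tail≢ xz) (tail≢ yz))

  -- The leading bits distribute the four points over the two copies. If all lie in one copy,
  -- `noFour` applies, after undoing the translation if necessary; any other pattern is sorted by
  -- adjacent swaps into 3 + 1, 1 + 3 or 2 + 2.
  extend-noFour : NoFour (cubePoint (v ∷ vs))
  extend-noFour (false ∷ x) (false ∷ y) (false ∷ z) (false ∷ w) xy xz xw yz yw zw =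
    noFour x y z w (tail≢ xy) (tail≢ xz) (tail≢ xw) (tail≢ yz) (tail≢ yw) (tail≢ zw)
  extend-noFour (true ∷ x) (true ∷ y) (true ∷ z) (true ∷ w) xy xz xw yz yw zw =
    subst (_≢ 0ℚ) (sym (incircle-⊕ (f x) (f y) (f z) (f w) v))
      (noFour x y z w (tail≢ xy) (tail≢ xz) (tail≢ xw) (tail≢ yz) (tail≢ yw) (tail≢ zw))
  extend-noFour (false ∷ x) (false ∷ y) (false ∷ z) (true ∷ w) xy xz _ yz _ _ =
    three∣1 x y z w (tail≢ xy) (tail≢ xz) (tail≢ yz)
  extend-noFour (false ∷ x) (false ∷ y) (true ∷ z) (false ∷ w) xy _ xw _ yw _ =
    swap₃₄ (f x) (f y) (f w) (f′ z) (three∣1 x y w z (tail≢ xy) (tail≢ xw) (tail≢ yw))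
  extend-noFour (false ∷ x) (true ∷ y) (false ∷ z) (false ∷ w) _ xz xw _ _ zw =
    swap₂₃ (f x) (f z) (f′ y) (f w) (swap₃₄ (f x) (f z) (f w) (f′ y)
      (three∣1 x z w y (tail≢ xz) (tail≢ xw) (tail≢ zw)))
  extend-noFour (true ∷ x) (false ∷ y) (false ∷ z) (false ∷ w) _ _ _ yz yw zw =
    swap₁₂ (f y) (f′ x) (f z) (f w) (swap₂₃ (f y) (f z) (f′ x) (f w) (swap₃₄ (f y) (f z) (f w) (f′ x)
      (three∣1 y z w x (tail≢ yz) (tail≢ yw) (tail≢ zw))))
  extend-noFour (true ∷ x) (true ∷ y) (true ∷ z) (false ∷ w) xy xz _ yz _ _ =
    one∣3 x y z w (tail≢ xy) (tail≢ xz) (tail≢ yz)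
  extend-noFour (true ∷ x) (true ∷ y) (false ∷ z) (true ∷ w) xy _ xw _ yw _ =
    swap₃₄ (f′ x) (f′ y) (f′ w) (f z) (one∣3 x y w z (tail≢ xy) (tail≢ xw) (tail≢ yw))
  extend-noFour (true ∷ x) (false ∷ y) (true ∷ z) (true ∷ w) _ xz xw _ _ zw =
    swap₂₃ (f′ x) (f′ z) (f y) (f′ w) (swap₃₄ (f′ x) (f′ z) (f′ w) (f y)
      (one∣3 x z w y (tail≢ xz) (tail≢ xw) (tail≢ zw)))
  extend-noFour (false ∷ x) (true ∷ y) (true ∷ z) (true ∷ w) _ _ _ yz yw zw =
    swap₁₂ (f′ y) (f x) (f′ z) (f′ w) (swap₂₃ (f′ y) (f′ z) (f x) (f′ w) (swap₃₄ (f′ y) (f′ z) (f′ w) (f x)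
      (one∣3 y z w x (tail≢ yz) (tail≢ yw) (tail≢ zw))))
  extend-noFour (false ∷ x) (false ∷ y) (true ∷ z) (true ∷ w) xy _ _ _ _ zw =
    two∣2 x y z w (tail≢ xy) (tail≢ zw)
  extend-noFour (false ∷ x) (true ∷ y) (false ∷ z) (true ∷ w) _ xz _ _ yw _ =
    swap₂₃ (f x) (f z) (f′ y) (f′ w) (two∣2 x z y w (tail≢ xz) (tail≢ yw))
  extend-noFour (false ∷ x) (true ∷ y) (true ∷ z) (false ∷ w) _ _ xw yz _ _ =
    swap₃₄ (f x) (f′ y) (f w) (f′ z) (swap₂₃ (f x) (f w) (f′ y) (f′ z)
      (two∣2 x w y z (tail≢ xw) (tail≢ yz)))
  extend-noFour (true ∷ x) (true ∷ y) (false ∷ z) (false ∷ w) xy _ _ _ _ zw =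
    swap₂₃ (f′ x) (f z) (f′ y) (f w) (swap₃₄ (f′ x) (f z) (f w) (f′ y)
      (swap₁₂ (f z) (f′ x) (f w) (f′ y) (swap₂₃ (f z) (f w) (f′ x) (f′ y)
        (two∣2 z w x y (tail≢ zw) (tail≢ xy)))))
  extend-noFour (true ∷ x) (false ∷ y) (true ∷ z) (false ∷ w) _ xz _ _ yw _ =
    swap₃₄ (f′ x) (f y) (f w) (f′ z) (swap₁₂ (f y) (f′ x) (f w) (f′ z)
      (swap₂₃ (f y) (f w) (f′ x) (f′ z) (two∣2 y w x z (tail≢ yw) (tail≢ xz))))
  extend-noFour (true ∷ x) (false ∷ y) (false ∷ z) (true ∷ w) _ _ xw yz _ _ =
    swap₁₂ (f y) (f′ x) (f z) (f′ w) (swap₂₃ (f y) (f z) (f′ x) (f′ w)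
      (two∣2 y z x w (tail≢ yz) (tail≢ xw)))

generalProjection : ∀ d → ∃[ vs ] GeneralProjection {d} vs
generalProjection zero = [] , record
  { injects = λ { [] [] ≢ → contradiction refl ≢ }
  ; noThree = λ { [] [] _ ≢ → contradiction refl ≢ }
  ; noFour  = λ { [] [] _ _ ≢ → contradiction refl ≢ }
  }
generalProjection (suc d) =
  let vs , general = generalProjection d
      open GeneralProjection general
      v , separates = separating (cubePoint vs) injects noThree
  in v ∷ vs , record
    { injects = extend-injects general separates
    ; noThree = extend-noThree general separates
    ; noFour  = extend-noFour general separates
    }

-- Coordinatewise, only the differences of the endpoints and the centre matter;
-- they coincide for (0,0,0) and (1,1,1), which leaves 7 cases.
code : Bool → Bool → Bool → Fin 7
code false false false = 0F
code true  true  true  = 0F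
code false false true  = 1F
code false true  false = 2F
code false true  true  = 3F
code true  false false = 4F
code true  false true  = 5F
code true  true  false = 6F

shift : Bool → Bool → ℚ² → ℚ²
shift false true  v = ⊝ v
shift true  false v = v
shift _     _     v = 0ℚ , 0ℚ

-- Both coordinate differences factor through the code. Equal codes thus give equal differences,
-- without comparing 8 × 8 combinations of bits.
decode : Fin 7 → (ℚ² → ℚ²) × (ℚ² → ℚ²)
decode 0F = shift false false , shift false false
decode 1F = shift false false , shift true  false
decode 2F = shift false true  , shift false true
decode 3F = shift false true  , shift true  true
decode 4F = shift true  false , shift false false
decode 5F = shift true  false , shift true  false
decode 6F = shift true  true  , shift false true

decode-code : ∀ a b c v → proj₁ (decode (code a b c)) v ≡ shift a b v ×
                          proj₂ (decode (code a b c)) v ≡ shift c b v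
decode-code false false false v = refl , refl
decode-code true  true  true  v = refl , refl
decode-code false false true  v = refl , refl
decode-code false true  false v = refl , refl
decode-code false true  true  v = refl , refl
decode-code true  false false v = refl , refl
decode-code true  false true  v = refl , refl
decode-code true  true  false v = refl , refl

⊕-identityʳ : ∀ p → p ⊕ (0ℚ , 0ℚ) ≡ p
⊕-identityʳ (a , b) = cong₂ _,_ (ℚₚ.+-identityʳ a) (ℚₚ.+-identityʳ b)

cubePoint-⊖ : ∀ {d} v (vs : Vec ℚ² d) a x b y →
  cubePoint (v ∷ vs) (a ∷ x) ⊖ cubePoint (v ∷ vs) (b ∷ y) ≡ (cubePoint vs x ⊖ cubePoint vs y) ⊕ shift a b v
cubePoint-⊖ v vs false x false y = sym (⊕-identityʳ (cubePoint vs x ⊖ cubePoint vs y))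
cubePoint-⊖ v vs true x true y = trans (⊖-⊕-cancel (cubePoint vs x) v (cubePoint vs y))
  (sym (⊕-identityʳ (cubePoint vs x ⊖ cubePoint vs y)))
cubePoint-⊖ v vs true  x false y = ⊕-⊖-comm (cubePoint vs x) v (cubePoint vs y)
cubePoint-⊖ v vs false x true  y = rearrange (cubePoint vs x) (cubePoint vs y) v
  where
  identity : ∀ a b c → a ℚ.- (b ℚ.+ c) ≡ (a ℚ.- b) ℚ.+ (ℚ.- c)
  identity = solve-∀ ℚ-ring
  rearrange : ∀ p q v → p ⊖ (q ⊕ v) ≡ (p ⊖ q) ⊕ (⊝ v)
  rearrange (a , b) (c , d) (e , f) = cong₂ _,_ (identity a c e) (identity b d f)

cubeClass : ∀ {d} → Vec Bool d → Vec Bool d → Vec Bool d → Fin (7 ℕ.^ d)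
cubeClass []      []      []      = 0F
cubeClass (a ∷ x) (b ∷ y) (c ∷ z) = combine (code a b c) (cubeClass x y z)

cubeClass-differences : ∀ {d} (vs : Vec ℚ² d) x y z x′ y′ z′ → cubeClass x y z ≡ cubeClass x′ y′ z′ →
  cubePoint vs x ⊖ cubePoint vs y ≡ cubePoint vs x′ ⊖ cubePoint vs y′ ×
  cubePoint vs z ⊖ cubePoint vs y ≡ cubePoint vs z′ ⊖ cubePoint vs y′
cubeClass-differences []       []      []      []      []        []        []        _  = refl , refl
cubeClass-differences (v ∷ vs) (a ∷ x) (b ∷ y) (c ∷ z) (a′ ∷ x′) (b′ ∷ y′) (c′ ∷ z′) eq =
  let code≡ , class≡ = combine-injective (code a b c) (cubeClass x y z) (code a′ b′ c′) (cubeClass x′ y′ z′) eq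
      ab , cb = cubeClass-differences vs x y z x′ y′ z′ class≡
      s₁ , s₂ = decode-code a b c v
      s₁′ , s₂′ = decode-code a′ b′ c′ v
      δ₁ = trans (sym s₁) (trans (cong (λ k → proj₁ (decode k) v) code≡) s₁′)
      δ₂ = trans (sym s₂) (trans (cong (λ k → proj₂ (decode k) v) code≡) s₂′)
  in trans (cubePoint-⊖ v vs a x b y) (trans (cong₂ _⊕_ ab δ₁) (sym (cubePoint-⊖ v vs a′ x′ b′ y′))) ,
     trans (cubePoint-⊖ v vs c z b y) (trans (cong₂ _⊕_ cb δ₂) (sym (cubePoint-⊖ v vs c′ z′ b′ y′)))

-- Cube configurations for arbitrary n

bit : Fin 2 → Bool
bit 0F = false
bit 1F = true

bit-injective : ∀ i j → bit i ≡ bit j → i ≡ j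
bit-injective 0F 0F _ = refl
bit-injective 0F 1F ()
bit-injective 1F 0F ()
bit-injective 1F 1F _ = refl

bits : ∀ d → Fin (2 ℕ.^ d) → Vec Bool d
bits zero    _ = []
bits (suc d) i = bit (proj₁ (remQuot {2} (2 ℕ.^ d) i)) ∷ bits d (proj₂ (remQuot {2} (2 ℕ.^ d) i))

bits-injective : ∀ d i j → bits d i ≡ bits d j → i ≡ j
bits-injective zero    0F 0F _ = refl
bits-injective (suc d) i  j  eq =
  trans (sym (combine-remQuot {2} (2 ℕ.^ d) i))
    (trans (cong₂ combine (bit-injective _ _ (Vecₚ.∷-injectiveˡ eq))
                          (bits-injective d _ _ (Vecₚ.∷-injectiveʳ eq)))
      (combine-remQuot {2} (2 ℕ.^ d) j))

-- The upper power gives a cube with room for all points, the lower one bounds its dimension in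
-- terms of their number. The offset 2 is there because 2ᵈ < N has no solution d for N ≤ 1.
enclosing-powers : ∀ n → ∃[ d ] (2 ℕ.^ d ℕ.< 2 ℕ.+ n × 2 ℕ.+ n ℕ.≤ 2 ℕ.^ suc d)
enclosing-powers zero = 0 , ℕₚ.≤-refl , ℕₚ.≤-refl
enclosing-powers (suc n) =
  let d , lower , upper = enclosing-powers n
  in case 3 ℕ.+ n ℕₚ.≤? 2 ℕ.^ suc d of λ where
       (yes le) → d , ℕₚ.m≤n⇒m≤1+n lower , le
       (no ¬le) → suc d , s≤s (ℕ.s≤s⁻¹ (ℕₚ.≰⇒> ¬le)) ,
         ℕₚ.≤-trans (s≤s upper) (ℕₚ.^-monoʳ-< 2 ℕₚ.≤-refl (ℕₚ.n<1+n (suc d)))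

module _ {d : ℕ} {vs : Vec ℚ² d} (general : GeneralProjection vs)
         {n : ℕ} (n≤2^d : n ℕ.≤ 2 ℕ.^ d) where
  open GeneralProjection general

  vertex : Fin n → Vec Bool d
  vertex i = bits d (inject≤ i n≤2^d)

  vertex-≢ : ∀ i j → i ≢ j → vertex i ≢ vertex j
  vertex-≢ i j i≢j eq = i≢j (Finₚ.inject≤-injective n≤2^d n≤2^d i j (bits-injective d _ _ eq))

  cubeConfig : Fin n → ℚ²
  cubeConfig = cubePoint vs ∘ vertex

  cubeConfig-injective : ∀ {i j} → cubeConfig i ≡ cubeConfig j → i ≡ j
  cubeConfig-injective {i} {j} eq with i Finₚ.≟ j
  ... | yes i≡j = i≡j
  ... | no  i≢j = contradiction eq (injects (vertex i) (vertex j) (vertex-≢ i j i≢j))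

  noThree-cube : NoThree cubeConfig
  noThree-cube i j k i≢j i≢k j≢k = noThree (vertex i) (vertex j) (vertex k)
    (vertex-≢ i j i≢j) (vertex-≢ i k i≢k) (vertex-≢ j k j≢k)

  noFour-cube : NoFour cubeConfig
  noFour-cube i j k l i≢j i≢k i≢l j≢k j≢l k≢l =
    noFour (vertex i) (vertex j) (vertex k) (vertex l)
      (vertex-≢ i j i≢j) (vertex-≢ i k i≢k) (vertex-≢ i l i≢l)
      (vertex-≢ j k j≢k) (vertex-≢ j l j≢l) (vertex-≢ k l k≢l)

  transfer-cube : ∀ i j k i′ j′ k′ →
    cubeClass (vertex i) (vertex j) (vertex k) ≡ cubeClass (vertex i′) (vertex j′) (vertex k′) → ∀ θ →
    ∠ ⟦ cubeConfig i ⟧ , ⟦ cubeConfig j ⟧ , ⟦ cubeConfig k ⟧ is θ →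
    ∠ ⟦ cubeConfig i′ ⟧ , ⟦ cubeConfig j′ ⟧ , ⟦ cubeConfig k′ ⟧ is θ
  transfer-cube i j k i′ j′ k′ eq =
    let A≡ , B≡ = cubeClass-differences vs (vertex i) (vertex j) (vertex k) (vertex i′) (vertex j′) (vertex k′) eq
    in transfer-measure (cubeConfig i) (cubeConfig j) (cubeConfig k)
         (cubeConfig i′) (cubeConfig j′) (cubeConfig k′) 1ℚ 1ℚ
         (ℚₚ.<⇒≤ (ℚₚ.positive⁻¹ 1ℚ)) (ℚₚ.<⇒≤ (ℚₚ.positive⁻¹ 1ℚ))
         (scale (cong₂ dot A≡ A≡)) (scale (cong₂ dot B≡ B≡)) (scale (cong₂ dot A≡ B≡))
    where
    scale : ∀ {x y} → x ≡ y → y ≡ (1ℚ ℚ.* 1ℚ) ℚ.* x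
    scale {x} eq = trans (sym eq) (sym (trans (cong (ℚ._* x) (ℚₚ.*-identityˡ 1ℚ)) (ℚₚ.*-identityˡ x)))

  cube-cubed : ∀ Q → NoRepeatedAngle (⟦_⟧ ∘ cubeConfig) Q → ∣ Q ∣ ℕ.^ 3 ℕ.≤ 125 ℕ.* 7 ℕ.^ d
  cube-cubed = few-classes⇒small cubeConfig (λ i j k → cubeClass (vertex i) (vertex j) (vertex k))
    (ℕₚ.m^n>0 7 d)
    (λ i j k i<j j<k → noThree-cube j i k (≢-sym (Finₚ.<⇒≢ i<j)) (Finₚ.<⇒≢ j<k)
                                   (Finₚ.<⇒≢ (Finₚ.<-trans i<j j<k)))
    (λ i j k i′ j′ k′ _ _ _ _ eq θ → mk⇔
      (transfer-cube i j k i′ j′ k′ eq θ) (transfer-cube i′ j′ k′ i j k (sym eq) θ))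

-- The cube has dimension d + 1 but only 2ᵈ ≤ n is available; the surplus 7 goes into the constant,
-- as 125 · 7 = 875 ≤ 1000. Exchanging exponents turns 7^q < 2^(3p) into (7ᵈ)^q ≤ (2ᵈ)^(3p).
cube-small : ∀ {m n} d → 2 ℕ.^ d ℕ.≤ n → m ℕ.^ 3 ℕ.≤ 125 ℕ.* 7 ℕ.^ suc d → m ≤ 10 · n ^ₑ log₂7/3
cube-small {m} {n} d 2^d≤n m³≤ p q _ 7^q<2^3p = root-bound {m} {n} {7 ℕ.^ d} p q
  (ℕₚ.≤-trans m³≤ (begin
    125 ℕ.* (7 ℕ.* 7 ℕ.^ d)   ≡⟨ sym (ℕₚ.*-assoc 125 7 (7 ℕ.^ d)) ⟩
    875 ℕ.* 7 ℕ.^ d           ≤⟨ ℕₚ.*-monoˡ-≤ (7 ℕ.^ d) (ℕₚ.m≤m+n 875 125) ⟩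
    1000 ℕ.* 7 ℕ.^ d          ∎))
  (begin
    (7 ℕ.^ d) ℕ.^ q           ≡⟨ ^-swap 7 d q ⟩
    (7 ℕ.^ q) ℕ.^ d           ≤⟨ ℕₚ.^-monoˡ-≤ d (ℕₚ.<⇒≤ 7^q<2^3p) ⟩
    (2 ℕ.^ (3 ℕ.* p)) ℕ.^ d   ≡⟨ ^-swap 2 (3 ℕ.* p) d ⟩
    (2 ℕ.^ d) ℕ.^ (3 ℕ.* p)   ≤⟨ ℕₚ.^-monoˡ-≤ (3 ℕ.* p) 2^d≤n ⟩
    n ℕ.^ (3 ℕ.* p)           ∎)
  where open ℕₚ.≤-Reasoning

cube-isO : ∀ (𝒞 : PointClass) → (∀ {n} (p : Fin n → ℚ²) → NoThree p → NoFour p → 𝒞 (⟦_⟧ ∘ p)) →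
           MinR 𝒞 isO[n^ log₂7/3 ]
cube-isO 𝒞 inClass = witness⇒isO 𝒞 log₂7/3 10 3 family
  where
  family : ∀ n → 3 ℕ.≤ n → Σ (Points n) λ P → Admissible 𝒞 P ×
           (∀ Q → NoRepeatedAngle P Q → ∣ Q ∣ ≤ 10 · n ^ₑ log₂7/3)
  family 1 (s≤s ())
  family (suc (suc n)) 3≤n =
    let d , lower , upper = enclosing-powers n
        vs , general = generalProjection (suc d)
        noThree = noThree-cube general upper
    in ⟦_⟧ ∘ cubeConfig general upper ,
       admissible 𝒞 (cubeConfig general upper) 3≤n (cubeConfig-injective general upper) noThree
         (inClass (cubeConfig general upper) noThree (noFour-cube general upper)) ,
       λ Q noRep → cube-small d (ℕₚ.<⇒≤ lower) (cube-cubed general upper Q noRep)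

corollary6p3 : (R isO[n^ one-third ]) ×
    (R-no3l isO[n^ one-third ]) ×
    (R-no4c isO[n^ log₂7/3 ]) ×
    (R-gen isO[n^ log₂7/3 ])
corollary6p3 =
  R-isO , R-no3l-isO ,
  cube-isO NoFourConcyclic (λ p _ noFour → noFourConcyclic p noFour) ,
  cube-isO GeneralPosition (λ p noThree noFour → noThreeCollinear p noThree , noFourConcyclic p noFour)
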